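{- The following hold. (1) For any polynomial $f \in \mathbb{Z}[x]$ of degree $d \le 36$ with odd leading coefficient and odd constant coefficient, there exists a square-free polynomial $g \in \mathbb{Z}[x]$ of degree $d$ such that $L(f-g) \le 1$. (2) For any polynomial $f \in \mathbb{Z}[x]$ of degree $d \le 37$ with odd leading coefficient and even constant term, such that $0$ is a simple root of the reduction of $f$ modulo $2$, there exists a square-free polynomial $g \in \mathbb{Z}[x]$ of degree $d$ such that $L(f-g) \le 1$. (3) For any polynomial $f \in \mathbb{Z}[x]$ of degree $d \le 81$ with odd leading coefficient and odd constant coefficient, there exists a square-free polynomial $g \in \mathbb{Z}[x]$ of degree $d$ such that $L(f-g) \le 3$. (4) Let $f \in \mathbb{Z}[x]$ have degree $d \ge 9$ and odd leading coefficient, and let $\bar f(x) = \sum_{i=0}^{d} a_i x^i \in \mathbb{F}_2[x]$ be its reduction modulo $2$, with $\bar f_e(x) = \sum_{i=0}^{\lfloor d/2 \rfloor} a_{2i} x^i$ and $\bar f_o(x) = \sum_{i=0}^{\lfloor (d-1)/2 \rfloor} a_{2i+1} x^i$. Suppose that either (i) $\bar f_e$ is not divisible by any of $x, x+1, x^2+x+1$ in $\mathbb{F}_2[x]$ and $\bar f_o$ has at most $5$ distinct irreducible factors, or (ii) $\bar f_o$ is not divisible by any of $x, x+1, x^2+x+1$ and $\bar f_e$ has at most $5$ distinct irreducible factors. Then there exists a square-free polynomial $g \in \mathbb{Z}[x]$ of degree $d$ such that $L(f-g) \le 1$.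
   Context: For $h(x) = a_n x^n + \cdots + a_0 \in \mathbb{Z}[x]$, its length is $L(h) = |a_n| + \cdots + |a_0|$. A polynomial $g \in \mathbb{Z}[x]$ is called square-free if there is no polynomial $h \in \mathbb{Z}[x]$ of degree at least $1$ such that $h^2$ divides $g$. $\mathbb{F}_2$ is the field with two elements. -}

module Defs where

open import Data.Nat as ℕ using (ℕ; zero; suc; _≤_; _<_)
open import Data.Integer as ℤ using (ℤ; +_; ∣_∣; -_)
open import Data.Integer.Divisibility as ℤD using ()
open import Data.Bool using (Bool; true; false; _xor_; _∧_)
open import Data.List using (List; []; _∷_; map; length)
open import Data.Nat.ListAction using (sum)
open import Data.List.Relation.Unary.Any using (Any)
open import Data.List.Relation.Unary.All using (All)
open import Data.Product using (Σ; ∃; _×_; _,_)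
open import Data.Sum using (_⊎_)
open import Relation.Nullary using (¬_)
open import Relation.Binary.PropositionalEquality using (_≡_; _≢_)

-- Polynomials over a coefficient type A, as coefficient lists
-- (index i = coefficient of x^i). Lists differing by trailing zeros
-- represent the same polynomial; equality of polynomials is _≈P_.
module Poly {A : Set} (0# : A) (_⊕_ _⊗_ : A → A → A) where

  Pol : Set
  Pol = List A

  add : Pol → Pol → Pol
  add [] q = q
  add (a ∷ p) [] = a ∷ p
  add (a ∷ p) (b ∷ q) = (a ⊕ b) ∷ add p q

  scale : A → Pol → Pol
  scale a p = map (a ⊗_) p

  mul : Pol → Pol → Pol
  mul [] q = []
  mul (a ∷ p) q = add (scale a q) (0# ∷ mul p q)

  coeff : Pol → ℕ → A
  coeff [] i = 0#
  coeff (a ∷ p) zero = a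
  coeff (a ∷ p) (suc i) = coeff p i

  _≈P_ : Pol → Pol → Set
  p ≈P q = ∀ i → coeff p i ≡ coeff q i

  _∣P_ : Pol → Pol → Set
  h ∣P g = ∃ λ q → mul h q ≈P g

  HasDegree : Pol → ℕ → Set
  HasDegree p d = (coeff p d ≢ 0#) × (∀ i → d < i → coeff p i ≡ 0#)

  NonConstant : Pol → Set
  NonConstant p = ∃ λ i → (1 ≤ i) × (coeff p i ≢ 0#)

module PZ = Poly (+ 0) ℤ._+_ ℤ._*_
open PZ using () renaming (Pol to ℤ[x]) public

sub : ℤ[x] → ℤ[x] → ℤ[x]
sub f g = PZ.add f (map -_ g)

L : ℤ[x] → ℕ
L h = sum (map ∣_∣ h)

SquareFree : ℤ[x] → Set
SquareFree g = ¬ (∃ λ h → PZ.NonConstant h × PZ._∣P_ (PZ.mul h h) g)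

Odd : ℤ → Set
Odd z = ¬ (+ 2 ℤD.∣ z)

Even : ℤ → Set
Even z = + 2 ℤD.∣ z

GoodApprox : ℕ → ℤ[x] → ℕ → Set
GoodApprox k f d = ∃ λ g → PZ.HasDegree g d × SquareFree g × (L (sub f g) ≤ k)

𝔽₂ : Set
𝔽₂ = Bool

module P2 = Poly false _xor_ _∧_
open P2 using () renaming (Pol to 𝔽₂[x]) public

red : ℤ → 𝔽₂
red z = (∣ z ∣ ℕ.% 2) ℕ.≡ᵇ 1

reduce : ℤ[x] → 𝔽₂[x]
reduce f = map red f

evens odds : 𝔽₂[x] → 𝔽₂[x]
evens [] = []
evens (a ∷ p) = a ∷ odds p
odds [] = []
odds (a ∷ p) = evens p

X X+1 X²+X+1 X² : 𝔽₂[x]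
X = false ∷ true ∷ []
X+1 = true ∷ true ∷ []
X²+X+1 = true ∷ true ∷ true ∷ []
X² = false ∷ false ∷ true ∷ []

Irreducible : 𝔽₂[x] → Set
Irreducible p = P2.NonConstant p ×
  (∀ a b → P2._≈P_ (P2.mul a b) p → ¬ (P2.NonConstant a × P2.NonConstant b))

-- p has at most n distinct irreducible factors: there is a list of at
-- most n polynomials containing (up to equality) every irreducible
-- divisor of p. (Over 𝔽₂ every nonzero polynomial is monic, so
-- distinct irreducible factors are distinct as polynomials.)
AtMostIrredFactors : ℕ → 𝔽₂[x] → Set
AtMostIrredFactors n p = ∃ λ (ps : List 𝔽₂[x]) → (length ps ≤ n) ×
  (∀ q → Irreducible q → P2._∣P_ q p → Any (P2._≈P_ q) ps)

NotDivBySmall : 𝔽₂[x] → Set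
NotDivBySmall p = ¬ P2._∣P_ X p × ¬ P2._∣P_ X+1 p × ¬ P2._∣P_ X²+X+1 p

SimpleRootZero : 𝔽₂[x] → Set
SimpleRootZero p = P2._∣P_ X p × ¬ P2._∣P_ X² p

{-# OPTIONS --safe #-}
-- Modulo 2 a polynomial is e(x²) + x·o(x²) = e(x)² + x·o(x)², so if h² divides it then h divides
-- both e and o. It therefore suffices to change one coefficient of e (or of o) by x^j so that e and o
-- lose every common divisor. A common divisor with value 1 at 1 suffices to be excluded: if h̄(1) = 0
-- then h(−1) is even and 4 divides g(−1), which fails for one of the two signs of ±x^k.
--
-- An irreducible p dividing o divides e + x^j for at most one class of j modulo the order of x mod p.
-- Over 9 consecutive exponents the only relevant orders are 3, 5, 7, 7 (Φ₃, Φ₅ and the two cubics);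
-- outside the classes hit by these, the gcds of o with e + x^j are pairwise coprime of degree at least 4.
-- If no j works, the product of all these divisors exceeds the degree of o, or the number of irreducible
-- factors allowed. Which of the two blocks of 9 exponents to use depends on the classes; that some block
-- always does is a finite computation.
--
-- For three changes and degree above 37, two of them make e coprime to x, x + 1, Φ₃, Φ₅, the cubics and Φ₉.
-- Then eleven consecutive exponents give eleven coprime divisors of e of degree at least 4, more than 40.
module Submission where

open import Defs
open import Algebra.Bundles using (CommutativeRing)
open import Data.Bool using (Bool; true; false; _xor_; _∧_; _∨_; not; T; if_then_else_)
import Data.Bool.Properties as 𝔹ₚ
open import Data.Empty using (⊥; ⊥-elim)
open import Data.Integer as ℤ using (ℤ; +_; -[1+_]; -_)
import Data.Integer.Divisibility.Signed as ℤS
import Data.Integer.Properties as ℤₚ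
import Data.Integer.Tactic.RingSolver as ℤ-Solver
open import Data.List using (List; []; _∷_; map; length; foldr; filter)
open import Data.List.Relation.Unary.All as All using (All; []; _∷_)
import Data.List.Relation.Unary.All.Properties as Allₚ
open import Data.List.Relation.Unary.AllPairs as AllPairs using (AllPairs; []; _∷_)
import Data.List.Relation.Unary.AllPairs.Properties as AllPairsₚ
open import Data.List.Relation.Unary.Any using (Any; here; there)
open import Data.Maybe using (nothing)
open import Data.Nat as ℕ using (ℕ; zero; suc; _≤_; _<_; _+_; _*_; z≤n; s≤s; _%_; _≡ᵇ_; _<ᵇ_)
import Data.Nat.DivMod as DivMod
import Data.Nat.Divisibility as ℕD
open import Data.Nat.ListAction using (sum)
import Data.Nat.Properties as ℕₚ
import Data.Nat.Tactic.RingSolver as ℕ-Solver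
open import Data.Product using (∃; _×_; _,_; proj₁; proj₂)
open import Data.Sum using (_⊎_; inj₁; inj₂; map₁; map₂; [_,_]) renaming (map to map-⊎)
open import Data.Unit using (tt)
open import Function using (_on_; _∘_)
open import Level using (0ℓ)
open import Relation.Binary.Definitions using (DecidableEquality)
open import Relation.Binary.PropositionalEquality using (_≡_; _≢_; refl; sym; trans; cong; cong₂; subst)
open import Relation.Binary.Structures using (IsEquivalence)
open import Relation.Nullary using (¬_; yes; no)
open import Relation.Nullary.Decidable using (¬?; toWitness; _×-dec_)
open import Tactic.RingSolver using (solve-∀)
open import Tactic.RingSolver.Core.AlmostCommutativeRing using (AlmostCommutativeRing; fromCommutativeRing)

-- Degrees of polynomials over an integral domain.

module Degree {A : Set} (0# : A) (_⊕_ _⊗_ : A → A → A)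
  (identityˡ : ∀ a → 0# ⊕ a ≡ a) (identityʳ : ∀ a → a ⊕ 0# ≡ a)
  (zeroˡ : ∀ a → 0# ⊗ a ≡ 0#) (zeroʳ : ∀ a → a ⊗ 0# ≡ 0#)
  (noZeroDivisors : ∀ {a b} → a ≢ 0# → b ≢ 0# → a ⊗ b ≢ 0#)
  (_≟_ : DecidableEquality A) where

  open Poly 0# _⊕_ _⊗_

  -- Lists may end in zeros, so degrees enter only as bounds. `DegGe p 0` says that `p` is nonzero,
  -- `DegLt p 0` that it is zero.
  record DegGe (p : Pol) (k : ℕ) : Set where
    constructor degGe
    field
      index : ℕ
      k≤index : k ≤ index
      nonzero : coeff p index ≢ 0#

  record DegLt (p : Pol) (n : ℕ) : Set where
    constructor degLt
    field vanish : ∀ i → n ≤ i → coeff p i ≡ 0#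

  coeff-add : ∀ p q i → coeff (add p q) i ≡ coeff p i ⊕ coeff q i
  coeff-add [] q i = sym (identityˡ _)
  coeff-add (a ∷ p) [] zero = sym (identityʳ _)
  coeff-add (a ∷ p) [] (suc i) = sym (identityʳ _)
  coeff-add (a ∷ p) (b ∷ q) zero = refl
  coeff-add (a ∷ p) (b ∷ q) (suc i) = coeff-add p q i

  coeff-scale : ∀ a p i → coeff (scale a p) i ≡ a ⊗ coeff p i
  coeff-scale a [] i = sym (zeroʳ a)
  coeff-scale a (b ∷ p) zero = refl
  coeff-scale a (b ∷ p) (suc i) = coeff-scale a p i

  mul-zero-coeffs : ∀ p q → DegLt p 0 → DegLt (mul p q) 0
  mul-zero-coeffs [] q p0 = degLt λ _ _ → refl
  mul-zero-coeffs (a ∷ p) q (degLt p0) = degLt λ i _ →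
    trans (coeff-add (scale a q) _ i)
      (trans (cong₂ _⊕_ (left i) (right i)) (identityˡ 0#))
    where
    left : ∀ i → coeff (scale a q) i ≡ 0#
    left i = trans (coeff-scale a q i) (trans (cong (_⊗ _) (p0 0 z≤n)) (zeroˡ _))
    right : ∀ i → coeff (0# ∷ mul p q) i ≡ 0#
    right zero = refl
    right (suc i) = DegLt.vanish (mul-zero-coeffs p q (degLt λ j _ → p0 (suc j) z≤n)) i z≤n

  -- Induction strips low coefficients off `p`: while `m` is positive, `scale a q` does not reach
  -- index `m + n`, and at `m = 0` the tail of `p` vanishes.
  coeff-mul-top : ∀ p q m n → DegLt p (suc m) → DegLt q (suc n) →
    coeff (mul p q) (m + n) ≡ coeff p m ⊗ coeff q n
  coeff-mul-top [] q m n p< q< = sym (zeroˡ _)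
  coeff-mul-top (a ∷ p) q zero n (degLt p<) (degLt q<) =
    trans (coeff-add (scale a q) _ n)
      (trans (cong₂ _⊕_ (coeff-scale a q n) (right n)) (identityʳ _))
    where
    right : ∀ i → coeff (0# ∷ mul p q) i ≡ 0#
    right zero = refl
    right (suc i) = DegLt.vanish (mul-zero-coeffs p q (degLt λ j _ → p< (suc j) (s≤s z≤n))) i z≤n
  coeff-mul-top (a ∷ p) q (suc m) n (degLt p<) (degLt q<) =
    trans (coeff-add (scale a q) _ (suc (m + n)))
      (trans (cong₂ _⊕_
        (trans (coeff-scale a q _) (trans (cong (a ⊗_) (q< _ (s≤s (ℕₚ.m≤n+m n m)))) (zeroʳ a)))
        (coeff-mul-top p q m n (degLt λ j m<j → p< (suc j) (s≤s m<j)) (degLt q<)))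
      (identityˡ _))

  DegGe⇒HasDegree : ∀ p k → DegGe p k → ∃ λ m → k ≤ m × HasDegree p m
  DegGe⇒HasDegree [] k (degGe i _ pi≢0) = ⊥-elim (pi≢0 refl)
  DegGe⇒HasDegree (a ∷ p) k (degGe i k≤i pi≢0) with top p
    where
    top : ∀ p → (∃ λ m → HasDegree p m) ⊎ DegLt p 0
    top [] = inj₂ (degLt λ _ _ → refl)
    top (a ∷ p) with top p
    ... | inj₁ (m , pm≢0 , p<) = inj₁ (suc m , pm≢0 , λ { (suc j) (s≤s m<j) → p< j m<j })
    ... | inj₂ (degLt p0) with a ≟ 0#
    ...   | yes refl = inj₂ (degLt λ { zero _ → refl ; (suc j) _ → p0 j z≤n })
    ...   | no a≢0 = inj₁ (0 , a≢0 , λ { (suc j) _ → p0 j z≤n })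
  DegGe⇒HasDegree (a ∷ p) k (degGe zero z≤n pi≢0) | inj₂ (degLt p0) = 0 , z≤n , pi≢0 , λ { (suc j) _ → p0 j z≤n }
  DegGe⇒HasDegree (a ∷ p) k (degGe (suc i) k≤i pi≢0) | inj₂ (degLt p0) = ⊥-elim (pi≢0 (p0 i z≤n))
  DegGe⇒HasDegree (a ∷ p) k (degGe i k≤i pi≢0) | inj₁ (m , pm≢0 , p<) =
    suc m , ℕₚ.≤-trans k≤i (bound i pi≢0) , pm≢0 , λ { (suc j) (s≤s m<j) → p< j m<j }
    where
    bound : ∀ i → coeff (a ∷ p) i ≢ 0# → i ≤ suc m
    bound zero _ = z≤n
    bound (suc i) pi≢0 with i ℕ.≤? m
    ... | yes i≤m = s≤s i≤m
    ... | no i≰m = ⊥-elim (pi≢0 (p< i (ℕₚ.≰⇒> i≰m)))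

  DegGe-mul : ∀ p q m n → DegGe p m → DegGe q n → DegGe (mul p q) (m + n)
  DegGe-mul p q m n p≥ q≥ with DegGe⇒HasDegree p m p≥ | DegGe⇒HasDegree q n q≥
  ... | m′ , m≤m′ , pm≢0 , p< | n′ , n≤n′ , qn≢0 , q< =
    degGe (m′ + n′) (ℕₚ.+-mono-≤ m≤m′ n≤n′)
      λ e → noZeroDivisors pm≢0 qn≢0 (trans (sym (coeff-mul-top p q m′ n′ (degLt p<) (degLt q<))) e)

-- The ring of polynomials over the field with two elements.

noZeroDivisors₂ : ∀ {a b : 𝔽₂} → a ≢ false → b ≢ false → a ∧ b ≢ false
noZeroDivisors₂ {false} a≢0 _ _ = a≢0 refl
noZeroDivisors₂ {true} _ b≢0 = b≢0

module D2 = Degree false _xor_ _∧_ 𝔹ₚ.xor-identityˡ 𝔹ₚ.xor-identityʳ 𝔹ₚ.∧-zeroˡ 𝔹ₚ.∧-zeroʳ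
  noZeroDivisors₂ 𝔹ₚ._≟_

open P2 using (add; scale; mul; coeff)
open D2 using (DegGe; DegLt; degGe; degLt; coeff-add; coeff-scale; DegGe-mul)

-- A record rather than a function type, so that both sides can be inferred.
infix 4 _≋_
record _≋_ (p q : 𝔽₂[x]) : Set where
  constructor mk
  field at : P2._≈P_ p q
open _≋_

≋-isEquivalence : IsEquivalence _≋_
≋-isEquivalence = record
  { refl = mk λ _ → refl
  ; sym = λ e → mk λ i → sym (at e i)
  ; trans = λ e f → mk λ i → trans (at e i) (at f i)
  }

open IsEquivalence ≋-isEquivalence using ()
  renaming (refl to ≋-refl; sym to ≋-sym; trans to ≋-trans; reflexive to ≡⇒≋)

∷-cong : ∀ {a b p q} → a ≡ b → p ≋ q → (a ∷ p) ≋ (b ∷ q)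
∷-cong e f = mk λ { zero → e ; (suc i) → at f i }

tail-≋ : ∀ {a b p q} → (a ∷ p) ≋ (b ∷ q) → p ≋ q
tail-≋ e = mk λ i → at e (suc i)

0∷0 : (false ∷ []) ≋ []
0∷0 = mk λ { zero → refl ; (suc _) → refl }

add-cong : ∀ {p p′ q q′} → p ≋ p′ → q ≋ q′ → add p q ≋ add p′ q′
add-cong {p} {p′} {q} {q′} e f = mk λ i →
  trans (coeff-add p q i) (trans (cong₂ _xor_ (at e i) (at f i)) (sym (coeff-add p′ q′ i)))

scale-cong : ∀ {a p q} → p ≋ q → scale a p ≋ scale a q
scale-cong {a} {p} {q} e = mk λ i →
  trans (coeff-scale a p i) (trans (cong (a ∧_) (at e i)) (sym (coeff-scale a q i)))

add-identityʳ : ∀ p → add p [] ≡ p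
add-identityʳ [] = refl
add-identityʳ (a ∷ p) = refl

add-comm : ∀ p q → add p q ≡ add q p
add-comm [] q = sym (add-identityʳ q)
add-comm (a ∷ p) [] = refl
add-comm (a ∷ p) (b ∷ q) = cong₂ _∷_ (𝔹ₚ.xor-comm a b) (add-comm p q)

add-assoc : ∀ p q r → add (add p q) r ≡ add p (add q r)
add-assoc [] q r = refl
add-assoc (a ∷ p) [] r = refl
add-assoc (a ∷ p) (b ∷ q) [] = refl
add-assoc (a ∷ p) (b ∷ q) (c ∷ r) = cong₂ _∷_ (𝔹ₚ.xor-assoc a b c) (add-assoc p q r)

add-self : ∀ p → add p p ≋ []
add-self p = mk λ i → trans (coeff-add p p i) (𝔹ₚ.xor-same (coeff p i))

add-interchange : ∀ p q r s → add (add p q) (add r s) ≡ add (add p r) (add q s)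
add-interchange p q r s = trans (add-assoc p q (add r s)) (trans (cong (add p)
  (trans (sym (add-assoc q r s)) (trans (cong (λ t → add t s) (add-comm q r)) (add-assoc r q s))))
  (sym (add-assoc p r (add q s))))

scale-true : ∀ p → scale true p ≡ p
scale-true [] = refl
scale-true (a ∷ p) = cong (a ∷_) (scale-true p)

scale-false : ∀ p → scale false p ≋ []
scale-false p = mk (coeff-scale false p)

scale-distribʳ : ∀ a b p → scale (a xor b) p ≋ add (scale a p) (scale b p)
scale-distribʳ a b p = mk λ i → trans (coeff-scale (a xor b) p i)
  (trans (𝔹ₚ.∧-distribʳ-xor (coeff p i) a b)
  (sym (trans (coeff-add (scale a p) _ i) (cong₂ _xor_ (coeff-scale a p i) (coeff-scale b p i)))))

mul-congˡ : ∀ p {q r} → q ≋ r → mul p q ≋ mul p r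
mul-congˡ [] e = ≋-refl
mul-congˡ (a ∷ p) e = add-cong (scale-cong e) (∷-cong refl (mul-congˡ p e))

mul-zeroʳ : ∀ p → mul p [] ≋ []
mul-zeroʳ [] = ≋-refl
mul-zeroʳ (a ∷ p) = ≋-trans (∷-cong refl (mul-zeroʳ p)) 0∷0

mul-∷ʳ : ∀ p b q → mul p (b ∷ q) ≋ add (scale b p) (false ∷ mul p q)
mul-∷ʳ [] b q = ≋-sym 0∷0
mul-∷ʳ (a ∷ p) b q = ∷-cong (cong (_xor false) (𝔹ₚ.∧-comm a b))
  (≋-trans (add-cong (≋-refl {scale a q}) (mul-∷ʳ p b q)) (≡⇒≋
    (trans (sym (add-assoc (scale a q) (scale b p) _))
    (trans (cong (λ t → add t (false ∷ mul p q)) (add-comm (scale a q) (scale b p)))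
    (add-assoc (scale b p) (scale a q) _)))))

mul-comm : ∀ p q → mul p q ≋ mul q p
mul-comm [] q = ≋-sym (mul-zeroʳ q)
mul-comm (a ∷ p) q = ≋-trans (add-cong (≋-refl {scale a q}) (∷-cong refl (mul-comm p q))) (≋-sym (mul-∷ʳ q a p))

mul-cong : ∀ {p p′ q q′} → p ≋ p′ → q ≋ q′ → mul p q ≋ mul p′ q′
mul-cong {p} {p′} {q} {q′} e f = ≋-trans (mul-congˡ p f)
  (≋-trans (mul-comm p q′) (≋-trans (mul-congˡ q′ e) (mul-comm q′ p′)))

mul-distribʳ : ∀ r p q → mul (add p q) r ≋ add (mul p r) (mul q r)
mul-distribʳ r [] q = ≋-refl
mul-distribʳ r (a ∷ p) [] = ≡⇒≋ (sym (add-identityʳ _))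
mul-distribʳ r (a ∷ p) (b ∷ q) =
  ≋-trans (add-cong (scale-distribʳ a b r) (∷-cong refl (mul-distribʳ r p q)))
    (≡⇒≋ (add-interchange (scale a r) (scale b r) (false ∷ mul p r) (false ∷ mul q r)))

mul-distribˡ : ∀ r p q → mul r (add p q) ≋ add (mul r p) (mul r q)
mul-distribˡ r p q = ≋-trans (mul-comm r (add p q))
  (≋-trans (mul-distribʳ r p q) (add-cong (mul-comm p r) (mul-comm q r)))

mul-scaleˡ : ∀ a q r → mul (scale a q) r ≋ scale a (mul q r)
mul-scaleˡ true q r = ≡⇒≋ (trans (cong (λ t → mul t r) (scale-true q)) (sym (scale-true _)))
mul-scaleˡ false q r = ≋-trans (mul-cong (scale-false q) (≋-refl {r})) (≋-sym (scale-false _))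

mul-shiftˡ : ∀ p q → mul (false ∷ p) q ≋ (false ∷ mul p q)
mul-shiftˡ p q = add-cong (scale-false q) (≋-refl {false ∷ mul p q})

mul-assoc : ∀ p q r → mul (mul p q) r ≋ mul p (mul q r)
mul-assoc [] q r = ≋-refl
mul-assoc (a ∷ p) q r = ≋-trans (mul-distribʳ r (scale a q) _)
  (add-cong (mul-scaleˡ a q r) (≋-trans (mul-shiftˡ (mul p q) r) (∷-cong refl (mul-assoc p q r))))

𝟙 : 𝔽₂[x]
𝟙 = true ∷ []

mul-identityˡ : ∀ p → mul 𝟙 p ≋ p
mul-identityˡ p = ≋-trans (add-cong (≡⇒≋ (scale-true p)) 0∷0) (≡⇒≋ (add-identityʳ p))

𝔽₂[x]-commutativeRing : CommutativeRing 0ℓ 0ℓ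
𝔽₂[x]-commutativeRing = record
  { Carrier = 𝔽₂[x] ; _≈_ = _≋_ ; _+_ = add ; _*_ = mul ; -_ = λ p → p ; 0# = [] ; 1# = 𝟙
  ; isCommutativeRing = record
    { isRing = record
      { +-isAbelianGroup = record
        { isGroup = record
          { isMonoid = record
            { isSemigroup = record
              { isMagma = record { isEquivalence = ≋-isEquivalence ; ∙-cong = add-cong }
              ; assoc = λ p q r → ≡⇒≋ (add-assoc p q r) }
            ; identity = (λ _ → ≋-refl) , λ p → ≡⇒≋ (add-identityʳ p) }
          ; inverse = add-self , add-self
          ; ⁻¹-cong = λ e → e }
        ; comm = λ p q → ≡⇒≋ (add-comm p q) }
      ; *-cong = mul-cong
      ; *-assoc = mul-assoc
      ; *-identity = mul-identityˡ , λ p → ≋-trans (mul-comm p 𝟙) (mul-identityˡ p)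
      ; distrib = mul-distribˡ , mul-distribʳ }
    ; *-comm = mul-comm }
  }

𝔽₂[x]-ring : AlmostCommutativeRing 0ℓ 0ℓ
𝔽₂[x]-ring = fromCommutativeRing 𝔽₂[x]-commutativeRing λ _ → nothing

open AlmostCommutativeRing 𝔽₂[x]-ring using () renaming (_+_ to infixl 6 _⊞_; _*_ to infixl 7 _⊠_)

⊞-cong : ∀ {p p′ q q′} → p ≋ p′ → q ≋ q′ → p ⊞ q ≋ p′ ⊞ q′
⊞-cong = add-cong

⊠-cong : ∀ {p p′ q q′} → p ≋ p′ → q ≋ q′ → p ⊠ q ≋ p′ ⊠ q′
⊠-cong = mul-cong

-- Degree bounds over the field with two elements.

DegGe-resp : ∀ {p q k} → p ≋ q → DegGe p k → DegGe q k
DegGe-resp e (degGe i k≤i pi) = degGe i k≤i λ z → pi (trans (at e i) z)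

DegLt-resp : ∀ {p q k} → p ≋ q → DegLt p k → DegLt q k
DegLt-resp e (degLt p<) = degLt λ i k≤i → trans (sym (at e i)) (p< i k≤i)

DegLt-mono : ∀ {p m n} → m ≤ n → DegLt p m → DegLt p n
DegLt-mono m≤n (degLt p<) = degLt λ i n≤i → p< i (ℕₚ.≤-trans m≤n n≤i)

DegGe-mono : ∀ {p m n} → m ≤ n → DegGe p n → DegGe p m
DegGe-mono m≤n (degGe i n≤i pi) = degGe i (ℕₚ.≤-trans m≤n n≤i) pi

DegLt-[] : ∀ {n} → DegLt [] n
DegLt-[] = degLt λ _ _ → refl

DegLt-∷ : ∀ {a p n} → DegLt p n → DegLt (a ∷ p) (suc n)
DegLt-∷ (degLt p<) = degLt λ { (suc i) (s≤s n≤i) → p< i n≤i }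

DegLt-tail : ∀ {a p n} → DegLt (a ∷ p) (suc n) → DegLt p n
DegLt-tail (degLt p<) = degLt λ i n≤i → p< (suc i) (s≤s n≤i)

DegLt-add : ∀ {n} p q → DegLt p n → DegLt q n → DegLt (p ⊞ q) n
DegLt-add p q (degLt p<) (degLt q<) =
  degLt λ i n≤i → trans (coeff-add p q i) (cong₂ _xor_ (p< i n≤i) (q< i n≤i))

DegLt0⇒≋[] : ∀ {p} → DegLt p 0 → p ≋ []
DegLt0⇒≋[] (degLt p0) = mk λ i → p0 i z≤n

DegGe⇒¬DegLt : ∀ {p k} → DegGe p k → ¬ DegLt p k
DegGe⇒¬DegLt (degGe i k≤i pi) (degLt p<) = pi (p< i k≤i)

true≢false : true ≢ false
true≢false ()

DegGe⊎DegLt : ∀ p k → DegGe p k ⊎ DegLt p k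
DegGe⊎DegLt [] k = inj₂ DegLt-[]
DegGe⊎DegLt (a ∷ p) (suc k) with DegGe⊎DegLt p k
... | inj₁ (degGe i k≤i pi) = inj₁ (degGe (suc i) (s≤s k≤i) pi)
... | inj₂ p< = inj₂ (DegLt-∷ p<)
DegGe⊎DegLt (true ∷ p) zero = inj₁ (degGe 0 z≤n true≢false)
DegGe⊎DegLt (false ∷ p) zero with DegGe⊎DegLt p 0
... | inj₁ (degGe i _ pi) = inj₁ (degGe (suc i) z≤n pi)
... | inj₂ (degLt p<) = inj₂ (degLt λ { zero _ → refl ; (suc i) _ → p< i z≤n })

coeff⇒DegGe : ∀ {p k} → coeff p k ≡ true → DegGe p k
coeff⇒DegGe {k = k} e = degGe k ℕₚ.≤-refl λ z → true≢false (trans (sym e) z)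

DegLt-suc : ∀ {p n} → coeff p n ≡ false → DegLt p (suc n) → DegLt p n
DegLt-suc {p} {n} pn (degLt p<) = degLt go
  where
  go : ∀ i → n ≤ i → coeff p i ≡ false
  go i n≤i with n ℕ.≟ i
  ... | yes refl = pn
  ... | no n≢i = p< i (ℕₚ.≤∧≢⇒< n≤i n≢i)

DegLt1⇒const : ∀ {p} → DegLt p 1 → p ≋ (coeff p 0 ∷ [])
DegLt1⇒const (degLt p<) = mk λ { zero → refl ; (suc i) → p< (suc i) (s≤s z≤n) }

-- Divisibility and coprimality.

infix 4 _∣_
record _∣_ (d p : 𝔽₂[x]) : Set where
  constructor divides
  field
    quotient : 𝔽₂[x]
    equality : d ⊠ quotient ≋ p

-- With a Bezout identity as the definition, products, divisors and cancellation reduce to ring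
-- identities, and unique factorization is never invoked.
record Coprime (p q : 𝔽₂[x]) : Set where
  constructor coprime
  field
    u v : 𝔽₂[x]
    bezout : u ⊠ p ⊞ v ⊠ q ≋ 𝟙

∣-refl : ∀ {p} → p ∣ p
∣-refl {p} = divides 𝟙 (≋-trans (mul-comm p 𝟙) (mul-identityˡ p))

∣-trans : ∀ {d p q} → d ∣ p → p ∣ q → d ∣ q
∣-trans {d} (divides s e) (divides t f) = divides (s ⊠ t)
  (≋-trans (≋-sym (mul-assoc d s t)) (≋-trans (⊠-cong e ≋-refl) f))

∣-respʳ : ∀ {d p q} → p ≋ q → d ∣ p → d ∣ q
∣-respʳ e (divides s f) = divides s (≋-trans f e)

∣-respˡ : ∀ {d d′ p} → d ≋ d′ → d ∣ p → d′ ∣ p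
∣-respˡ e (divides s f) = divides s (≋-trans (⊠-cong (≋-sym e) ≋-refl) f)

∣[] : ∀ {d} → d ∣ []
∣[] {d} = divides [] (mul-zeroʳ d)

∣-add : ∀ {d p q} → d ∣ p → d ∣ q → d ∣ p ⊞ q
∣-add {d} (divides s e) (divides t f) =
  divides (s ⊞ t) (≋-trans (mul-distribˡ d s t) (⊞-cong e f))

∣-mulʳ : ∀ {d p} q → d ∣ p → d ∣ p ⊠ q
∣-mulʳ {d} q (divides s e) = divides (s ⊠ q) (≋-trans (≋-sym (mul-assoc d s q)) (⊠-cong e ≋-refl))

∣-mulˡ : ∀ {d p} q → d ∣ p → d ∣ q ⊠ p
∣-mulˡ {d} {p} q d∣p = ∣-respʳ (mul-comm p q) (∣-mulʳ q d∣p)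

add-cancel : ∀ p q → (p ⊞ q) ⊞ q ≋ p
add-cancel p q = ≋-trans (≡⇒≋ (add-assoc p q q))
  (≋-trans (⊞-cong (≋-refl {p}) (add-self q)) (≡⇒≋ (add-identityʳ p)))

∣-add-cancelʳ : ∀ {d p q} → d ∣ p ⊞ q → d ∣ q → d ∣ p
∣-add-cancelʳ {p = p} {q} d∣p+q d∣q = ∣-respʳ (add-cancel p q) (∣-add d∣p+q d∣q)

∣-DegGe : ∀ {d p k} → d ∣ p → DegGe p 0 → DegGe d k → DegGe p k
∣-DegGe {d} {p} {k} (divides q e) p≥ d≥ with DegGe⊎DegLt q 0
... | inj₁ q≥ = DegGe-resp e (subst (DegGe _) (ℕₚ.+-identityʳ k) (DegGe-mul d q k 0 d≥ q≥))
... | inj₂ q0 = ⊥-elim (DegGe⇒¬DegLt p≥ (DegLt-resp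
  (≋-trans (≋-sym (≋-trans (⊠-cong (≋-refl {d}) (DegLt0⇒≋[] q0)) (mul-zeroʳ d))) e) DegLt-[]))

nonConstant∤𝟙 : ∀ {d} → DegGe d 1 → ¬ d ∣ 𝟙
nonConstant∤𝟙 d≥ d∣1 = DegGe⇒¬DegLt (∣-DegGe d∣1 (coeff⇒DegGe refl) d≥) (DegLt-∷ DegLt-[])

coprime-common : ∀ {p q d} → Coprime p q → d ∣ p → d ∣ q → d ∣ 𝟙
coprime-common (coprime u v e) d∣p d∣q = ∣-respʳ e (∣-add (∣-mulˡ u d∣p) (∣-mulˡ v d∣q))

coprime-sym : ∀ {p q} → Coprime p q → Coprime q p
coprime-sym {p} {q} (coprime u v e) = coprime v u (≋-trans (≡⇒≋ (add-comm (v ⊠ q) (u ⊠ p))) e)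

coprime-∣ˡ : ∀ {d p q} → d ∣ p → Coprime p q → Coprime d q
coprime-∣ˡ {d} {p} {q} (divides s e) (coprime u v f) = coprime (u ⊠ s) v
  (≋-trans (⊞-cong (≋-trans (lemma u s d) (⊠-cong (≋-refl {u}) e)) ≋-refl) f)
  where
  lemma : ∀ u s d → u ⊠ s ⊠ d ≋ u ⊠ (d ⊠ s)
  lemma = solve-∀ 𝔽₂[x]-ring

coprime-∣ʳ : ∀ {d p q} → d ∣ p → Coprime q p → Coprime q d
coprime-∣ʳ d∣p c = coprime-sym (coprime-∣ˡ d∣p (coprime-sym c))

coprime-respʳ : ∀ {p q r} → q ≋ r → Coprime p q → Coprime p r
coprime-respʳ {q = q} e (coprime u v f) = coprime u v (≋-trans (⊞-cong ≋-refl (⊠-cong (≋-refl {v}) (≋-sym e))) f)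

coprime-𝟙 : ∀ {p} → Coprime p 𝟙
coprime-𝟙 = coprime [] 𝟙 (mul-identityˡ 𝟙)

-- Multiply the two Bezout identities: every term of the product contains `w`, except the one with
-- `p ⊠ q`.
coprime-mul : ∀ {w p q} → Coprime w p → Coprime w q → Coprime w (p ⊠ q)
coprime-mul {w} {p} {q} (coprime u v e) (coprime s t f) =
  coprime (u ⊠ w ⊠ s ⊞ u ⊠ (t ⊠ q) ⊞ v ⊠ p ⊠ s) (v ⊠ t)
    (≋-trans (lemma w p q u v s t) (≋-trans (⊠-cong e f) (mul-identityˡ 𝟙)))
  where
  lemma : ∀ w p q u v s t →
    (u ⊠ w ⊠ s ⊞ u ⊠ (t ⊠ q) ⊞ v ⊠ p ⊠ s) ⊠ w ⊞ (v ⊠ t) ⊠ (p ⊠ q) ≋ (u ⊠ w ⊞ v ⊠ p) ⊠ (s ⊠ w ⊞ t ⊠ q)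
  lemma = solve-∀ 𝔽₂[x]-ring

-- Write `a` as `u ⊠ p ⊠ a ⊞ v ⊠ q ⊠ a`; use `q ∣ a` in the first term and `p ∣ a` in the second.
coprime-mul-∣ : ∀ {p q a} → Coprime p q → p ∣ a → q ∣ a → p ⊠ q ∣ a
coprime-mul-∣ {p} {q} {a} (coprime u v e) (divides s f) (divides t g) = divides (u ⊠ t ⊞ v ⊠ s)
  (≋-trans (lemma p q u v s t)
  (≋-trans (⊞-cong (⊠-cong (≋-refl {u ⊠ p}) g) (⊠-cong (≋-refl {v ⊠ q}) f))
  (≋-trans (≋-sym (mul-distribʳ a (u ⊠ p) (v ⊠ q)))
  (≋-trans (⊠-cong e ≋-refl) (mul-identityˡ a)))))
  where
  lemma : ∀ p q u v s t → (p ⊠ q) ⊠ (u ⊠ t ⊞ v ⊠ s) ≋ (u ⊠ p) ⊠ (q ⊠ t) ⊞ (v ⊠ q) ⊠ (p ⊠ s)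
  lemma = solve-∀ 𝔽₂[x]-ring

coprime-cancel : ∀ {h p t} → Coprime h p → h ∣ p ⊠ t → h ∣ t
coprime-cancel {h} {p} {t} (coprime u v e) h∣pt =
  ∣-respʳ (≋-trans (lemma h p t u v) (≋-trans (⊠-cong e ≋-refl) (mul-identityˡ t)))
    (∣-add (∣-mulʳ (u ⊠ t) ∣-refl) (∣-mulˡ v h∣pt))
  where
  lemma : ∀ h p t u v → h ⊠ (u ⊠ t) ⊞ v ⊠ (p ⊠ t) ≋ (u ⊠ h ⊞ v ⊠ p) ⊠ t
  lemma = solve-∀ 𝔽₂[x]-ring

-- Division with remainder and the Euclidean algorithm.

-- Division is by a polynomial b of degree n, and n is passed along.
clear : 𝔽₂[x] → ℕ → 𝔽₂[x] → 𝔽₂[x]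
clear b n r = if coeff r n then r ⊞ b else r

-- As in Horner's scheme, the remainder of the tail is multiplied by x, the next coefficient is
-- added, and `b` is subtracted once if degree `n` is reached.
rem quo : 𝔽₂[x] → ℕ → 𝔽₂[x] → 𝔽₂[x]
rem b n [] = []
rem b n (a ∷ p) = clear b n (a ∷ rem b n p)
quo b n [] = []
quo b n (a ∷ p) = coeff (a ∷ rem b n p) n ∷ quo b n p

scale-clear : ∀ b n r → scale (coeff r n) b ⊞ clear b n r ≋ r
scale-clear b n r with coeff r n
... | false = ⊞-cong (scale-false b) (≋-refl {r})
... | true = ≋-trans (≡⇒≋ (trans (cong (_⊞ (r ⊞ b)) (scale-true b)) (add-comm b (r ⊞ b)))) (add-cancel r b)

quo-rem : ∀ b n p → b ⊠ quo b n p ⊞ rem b n p ≋ p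
quo-rem b n [] = ≋-trans (≡⇒≋ (add-identityʳ _)) (mul-zeroʳ b)
quo-rem b n (a ∷ p) =
  ≋-trans (⊞-cong (mul-∷ʳ b c (quo b n p)) (≋-refl {clear b n r}))
  (≋-trans (rearrange (scale c b) (false ∷ b ⊠ quo b n p) (clear b n r))
  (≋-trans (⊞-cong (scale-clear b n r) (≋-refl {false ∷ b ⊠ quo b n p}))
  (∷-cong (𝔹ₚ.xor-identityʳ a) (≋-trans (≡⇒≋ (add-comm (rem b n p) _)) (quo-rem b n p)))))
  where
  r = a ∷ rem b n p
  c = coeff r n
  rearrange : ∀ x y z → x ⊞ y ⊞ z ≋ x ⊞ z ⊞ y
  rearrange = solve-∀ 𝔽₂[x]-ring

clear-DegLt : ∀ b n r → coeff b n ≡ true → DegLt b (suc n) → DegLt r (suc n) → DegLt (clear b n r) n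
clear-DegLt b n r bn b< r< with coeff r n in eq
... | false = DegLt-suc eq r<
... | true = DegLt-suc (trans (coeff-add r b n) (cong₂ _xor_ eq bn)) (DegLt-add r b r< b<)

rem-DegLt : ∀ b n p → coeff b n ≡ true → DegLt b (suc n) → DegLt (rem b n p) n
rem-DegLt b n [] bn b< = DegLt-[]
rem-DegLt b n (a ∷ p) bn b< = clear-DegLt b n _ bn b< (DegLt-∷ (rem-DegLt b n p bn b<))

record Bezout (p q : 𝔽₂[x]) : Set where
  constructor bezout
  field
    gcd : 𝔽₂[x]
    gcd∣p : gcd ∣ p
    gcd∣q : gcd ∣ q
    u v : 𝔽₂[x]
    identity : u ⊠ p ⊞ v ⊠ q ≋ gcd

-- If the coefficient of `q` at `n` vanishes, only the bound drops. Otherwise `q` has degree exactly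
-- `n` and can be divided by, so no degree is ever computed.
euclid : ∀ n p q → DegLt q n → Bezout p q
euclid zero p q q0 = bezout p ∣-refl (∣-respʳ (≋-sym (DegLt0⇒≋[] q0)) ∣[]) 𝟙 []
  (≋-trans (≡⇒≋ (add-identityʳ _)) (mul-identityˡ p))
euclid (suc n) p q q< with coeff q n in eq
... | false = euclid n p q (DegLt-suc eq q<)
... | true with euclid n q (rem q n p) (rem-DegLt q n p eq q<)
...   | bezout g g∣q g∣r u v e =
  bezout g (∣-respʳ (quo-rem q n p) (∣-add (∣-mulʳ (quo q n p) g∣q) g∣r)) g∣q v (u ⊞ v ⊠ quo q n p)
    (≋-trans (⊞-cong (⊠-cong (≋-refl {v}) (≋-sym (quo-rem q n p))) ≋-refl)
    (≋-trans (lemma u v q (quo q n p) (rem q n p))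
    (≋-trans (⊞-cong ≋-refl (add-self (v ⊠ (q ⊠ quo q n p))))
    (≋-trans (≡⇒≋ (add-identityʳ _)) e))))
  where
  lemma : ∀ u v q s r → v ⊠ (q ⊠ s ⊞ r) ⊞ (u ⊞ v ⊠ s) ⊠ q ≋ (u ⊠ q ⊞ v ⊠ r) ⊞ (v ⊠ (q ⊠ s) ⊞ v ⊠ (q ⊠ s))
  lemma = solve-∀ 𝔽₂[x]-ring

length-DegLt : ∀ p → DegLt p (length p)
length-DegLt [] = DegLt-[]
length-DegLt (a ∷ p) = DegLt-∷ (length-DegLt p)

gcdOf : ∀ p q → Bezout p q
gcdOf p q = euclid (length q) p q (length-DegLt q)

Common : 𝔽₂[x] → 𝔽₂[x] → Set
Common p q = ∃ λ d → DegGe d 1 × d ∣ p × d ∣ q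

coprime⊎common : ∀ p q → DegGe p 0 → Coprime p q ⊎ Common p q
coprime⊎common p q p≥ with gcdOf p q
... | bezout g g∣p g∣q u v e with DegGe⊎DegLt g 1
...   | inj₁ g≥ = inj₂ (g , g≥ , g∣p , g∣q)
...   | inj₂ g< with coeff g 0 in eq
...     | true = inj₁ (coprime u v (≋-trans e (subst (λ c → g ≋ (c ∷ [])) eq (DegLt1⇒const g<))))
-- A zero gcd would divide `p` and force `p` to be zero.
...     | false = ⊥-elim (DegGe⇒¬DegLt p≥ (DegLt-resp (g≋[] g∣p) DegLt-[]))
  where
  g≋[] : g ∣ p → [] ≋ p
  g≋[] (divides s f) = ≋-trans (≋-sym (⊠-cong (≋-trans (DegLt1⇒const g<)
    (subst (λ c → (c ∷ []) ≋ []) (sym eq) 0∷0)) (≋-refl {s}))) f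

coprime⇒¬common : ∀ {p q} → Coprime p q → ¬ Common p q
coprime⇒¬common c (d , d≥ , d∣p , d∣q) = nonConstant∤𝟙 d≥ (coprime-common c d∣p d∣q)

-- Values at 0 and 1, and the factors x and x + 1.

val₀ val₁ : 𝔽₂[x] → Bool
val₀ p = coeff p 0
val₁ [] = false
val₁ (a ∷ p) = a xor val₁ p

val₁-[] : ∀ {p} → p ≋ [] → val₁ p ≡ false
val₁-[] {[]} e = refl
val₁-[] {a ∷ p} e = cong₂ _xor_ (at e 0) (val₁-[] {p} (mk λ i → at e (suc i)))

val₁-resp : ∀ {p q} → p ≋ q → val₁ p ≡ val₁ q
val₁-resp {[]} e = sym (val₁-[] (≋-sym e))
val₁-resp {a ∷ p} {[]} e = val₁-[] e
val₁-resp {a ∷ p} {b ∷ q} e = cong₂ _xor_ (at e 0) (val₁-resp (tail-≋ e))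

xor-interchange : ∀ a b c d → (a xor b) xor (c xor d) ≡ (a xor c) xor (b xor d)
xor-interchange false false c d = refl
xor-interchange false true false d = refl
xor-interchange false true true d = refl
xor-interchange true false false d = refl
xor-interchange true false true d = 𝔹ₚ.not-involutive d
xor-interchange true true false d = sym (𝔹ₚ.not-involutive d)
xor-interchange true true true d = refl

val₁-add : ∀ p q → val₁ (p ⊞ q) ≡ val₁ p xor val₁ q
val₁-add [] q = refl
val₁-add (a ∷ p) [] = sym (𝔹ₚ.xor-identityʳ _)
val₁-add (a ∷ p) (b ∷ q) = trans (cong ((a xor b) xor_) (val₁-add p q)) (xor-interchange a b (val₁ p) (val₁ q))

val₁-scale : ∀ a p → val₁ (scale a p) ≡ a ∧ val₁ p
val₁-scale true p = cong val₁ (scale-true p)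
val₁-scale false p = val₁-[] (scale-false p)

val₁-mul : ∀ p q → val₁ (p ⊠ q) ≡ val₁ p ∧ val₁ q
val₁-mul [] q = refl
val₁-mul (a ∷ p) q = trans (val₁-add (scale a q) _)
  (trans (cong₂ _xor_ (val₁-scale a q) (val₁-mul p q)) (sym (𝔹ₚ.∧-distribʳ-xor (val₁ q) a (val₁ p))))

val₀-mul : ∀ p q → val₀ (p ⊠ q) ≡ val₀ p ∧ val₀ q
val₀-mul [] q = refl
val₀-mul (a ∷ p) q = trans (coeff-add (scale a q) _ 0)
  (trans (cong (_xor false) (coeff-scale a q 0)) (𝔹ₚ.xor-identityʳ _))

∧-trueˡ : ∀ {a b} → a ∧ b ≡ true → a ≡ true
∧-trueˡ {true} e = refl

∧-trueʳ : ∀ {a b} → a ∧ b ≡ true → b ≡ true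
∧-trueʳ {true} e = e

val₀-∣ : ∀ {h p} → h ∣ p → val₀ p ≡ true → val₀ h ≡ true
val₀-∣ {h} (divides s e) p1 = ∧-trueˡ (trans (sym (val₀-mul h s)) (trans (at e 0) p1))

X∣⇐val₀ : ∀ p → val₀ p ≡ false → ∃ λ t → X ⊠ t ≋ p
X∣⇐val₀ [] e = [] , mul-zeroʳ X
X∣⇐val₀ (false ∷ p) e = p , ≋-trans (mul-shiftˡ 𝟙 p) (∷-cong refl (mul-identityˡ p))

-- The remainder modulo x + 1 is a constant with the same value at 1 as `p`, hence zero.
X+1∣⇐val₁ : ∀ p → val₁ p ≡ false → ∃ λ t → X+1 ⊠ t ≋ p
X+1∣⇐val₁ p e = quo X+1 1 p , ≋-trans (≋-sym (≋-trans (⊞-cong ≋-refl r≋[]) (≡⇒≋ (add-identityʳ _)))) (quo-rem X+1 1 p)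
  where
  r = rem X+1 1 p
  r-const : r ≋ (coeff r 0 ∷ [])
  r-const = DegLt1⇒const (rem-DegLt X+1 1 p refl (length-DegLt X+1))
  r0 : coeff r 0 ≡ false
  r0 = trans (sym (trans (val₁-resp r-const) (𝔹ₚ.xor-identityʳ _)))
    (trans (sym (trans (val₁-add (X+1 ⊠ quo X+1 1 p) r) (cong (_xor val₁ r) (val₁-mul X+1 (quo X+1 1 p)))))
    (trans (val₁-resp (quo-rem X+1 1 p)) e))
  r≋[] : r ≋ []
  r≋[] = ≋-trans (subst (λ c → r ≋ (c ∷ [])) r0 r-const) 0∷0

coprime-X : ∀ {p} → val₀ p ≡ true → Coprime p X
coprime-X {true ∷ p} refl = coprime 𝟙 p (≋-trans (⊞-cong (mul-identityˡ (true ∷ p)) (≋-trans (mul-comm p X)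
  (≋-trans (mul-shiftˡ 𝟙 p) (∷-cong refl (mul-identityˡ p)))))
  (∷-cong refl (add-self p)))

coprime-X+1 : ∀ {p} → val₁ p ≡ true → Coprime p X+1
coprime-X+1 {p} e with X+1∣⇐val₁ (p ⊞ 𝟙) (trans (val₁-add p 𝟙) (cong (_xor true) e))
... | t , f = coprime 𝟙 t (≋-trans (⊞-cong (mul-identityˡ p) (≋-trans (mul-comm t X+1) f))
  (≋-trans (≡⇒≋ (sym (add-assoc p p 𝟙))) (⊞-cong (add-self p) (≋-refl {𝟙}))))

-- Exhaustive checks over bounded exponents and bounded degrees.

allBelow : ℕ → (ℕ → Bool) → Bool
allBelow zero P = true
allBelow (suc n) P = P n ∧ allBelow n P

allBelow-sound : ∀ n P → allBelow n P ≡ true → ∀ {k} → k < n → P k ≡ true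
allBelow-sound (suc n) P e {k} (s≤s k≤n) with k ℕ.≟ n
... | yes refl = ∧-trueˡ e
... | no k≢n = allBelow-sound n P (∧-trueʳ {P n} e) (ℕₚ.≤∧≢⇒< k≤n k≢n)

forallBits : ℕ → (𝔽₂[x] → Bool) → Bool
forallBits zero P = P []
forallBits (suc n) P = forallBits n (λ r → P (false ∷ r)) ∧ forallBits n (λ r → P (true ∷ r))

-- `forallBits n` tests lists of length exactly `n`; padding or cutting brings every polynomial of
-- degree below `n` to that form.
trim : ℕ → 𝔽₂[x] → 𝔽₂[x]
trim zero p = []
trim (suc n) [] = false ∷ trim n []
trim (suc n) (a ∷ p) = a ∷ trim n p

trim-≋ : ∀ n p → DegLt p n → p ≋ trim n p
trim-≋ zero p p< = DegLt0⇒≋[] p<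
trim-≋ (suc n) [] p< = ≋-trans (≋-sym 0∷0) (∷-cong refl (trim-≋ n [] DegLt-[]))
trim-≋ (suc n) (a ∷ p) p< = ∷-cong refl (trim-≋ n p (DegLt-tail p<))

forallBits-sound : ∀ n P → forallBits n P ≡ true → ∀ p → P (trim n p) ≡ true
forallBits-sound zero P e p = e
forallBits-sound (suc n) P e [] = forallBits-sound n _ (∧-trueˡ e) []
forallBits-sound (suc n) P e (false ∷ p) = forallBits-sound n _ (∧-trueˡ e) p
forallBits-sound (suc n) P e (true ∷ p) =
  forallBits-sound n _ (∧-trueʳ {forallBits n (λ r → P (false ∷ r))} e) p

isZero isOne isConstant : 𝔽₂[x] → Bool
isZero [] = true
isZero (a ∷ p) = not a ∧ isZero p
isOne [] = false
isOne (a ∷ p) = a ∧ isZero p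
isConstant [] = true
isConstant (a ∷ p) = isZero p

isZero-sound : ∀ p → isZero p ≡ true → p ≋ []
isZero-sound [] e = ≋-refl
isZero-sound (false ∷ p) e = ≋-trans (∷-cong refl (isZero-sound p e)) 0∷0

isZero-complete : ∀ p → p ≋ [] → isZero p ≡ true
isZero-complete [] e = refl
isZero-complete (a ∷ p) e = cong₂ (λ x y → not x ∧ y) (at e 0) (isZero-complete p (mk λ i → at e (suc i)))

isOne-sound : ∀ p → isOne p ≡ true → p ≋ 𝟙
isOne-sound (true ∷ p) e = ∷-cong refl (isZero-sound p e)

isConstant-sound : ∀ p → isConstant p ≡ true → DegLt p 1
isConstant-sound [] e = DegLt-[]
isConstant-sound (a ∷ p) e = DegLt-∷ (DegLt-resp (≋-sym (isZero-sound p e)) DegLt-[])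

⊞-isZero⇒≋ : ∀ p q → isZero (p ⊞ q) ≡ true → p ≋ q
⊞-isZero⇒≋ p q e = ≋-trans (≋-sym (add-cancel p q)) (⊞-cong (isZero-sound (p ⊞ q) e) (≋-refl {q}))

∨-elim : ∀ {ℓ} {C : Set ℓ} {a b} → a ∨ b ≡ true → (a ≡ true → C) → (b ≡ true → C) → C
∨-elim {a = true} e f g = f refl
∨-elim {a = false} e f g = g e

rem-isZero⇒∣ : ∀ b n p → isZero (rem b n p) ≡ true → b ∣ p
rem-isZero⇒∣ b n p e = divides (quo b n p) (≋-trans (≋-sym (≋-trans
  (⊞-cong ≋-refl (isZero-sound _ e)) (≡⇒≋ (add-identityʳ _)))) (quo-rem b n p))

∣⇒rem-isZero : ∀ b n p → coeff b n ≡ true → DegLt b (suc n) → b ∣ p → isZero (rem b n p) ≡ true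
∣⇒rem-isZero b n p bn b< b∣p with DegGe⊎DegLt (rem b n p) 0
... | inj₂ r0 = isZero-complete _ (DegLt0⇒≋[] r0)
... | inj₁ r≥ = ⊥-elim (DegGe⇒¬DegLt (∣-DegGe b∣r r≥ (coeff⇒DegGe bn)) (rem-DegLt b n p bn b<))
  where
  b∣r : b ∣ rem b n p
  b∣r = ∣-add-cancelʳ (∣-respʳ (≋-trans (≋-sym (quo-rem b n p)) (≡⇒≋ (add-comm (b ⊠ quo b n p) _))) b∣p)
    (∣-mulʳ (quo b n p) ∣-refl)

coprime-add : ∀ {q r} s → Coprime q r → Coprime q (q ⊠ s ⊞ r)
coprime-add {q} {r} s (coprime u v e) = coprime (u ⊞ v ⊠ s) v
  (≋-trans (lemma q r s u v) (≋-trans (⊞-cong ≋-refl (add-self (v ⊠ (q ⊠ s)))) (≋-trans (≡⇒≋ (add-identityʳ _)) e)))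
  where
  lemma : ∀ q r s u v → (u ⊞ v ⊠ s) ⊠ q ⊞ v ⊠ (q ⊠ s ⊞ r) ≋ (u ⊠ q ⊞ v ⊠ r) ⊞ (v ⊠ (q ⊠ s) ⊞ v ⊠ (q ⊠ s))
  lemma = solve-∀ 𝔽₂[x]-ring

gcd⇒coprime : ∀ p q → isOne (Bezout.gcd (gcdOf p q)) ≡ true → Coprime p q
gcd⇒coprime p q e = coprime (Bezout.u g) (Bezout.v g) (≋-trans (Bezout.identity g) (isOne-sound _ e))
  where g = gcdOf p q

-- For `q` of degree `n`, it suffices to test the possible remainders modulo `q`: each must be zero
-- or coprime to `q`.
isPrimeᵇ : 𝔽₂[x] → ℕ → Bool
isPrimeᵇ q n = forallBits n λ r → isZero r ∨ isOne (Bezout.gcd (gcdOf q r))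

isPrimeᵇ-sound : ∀ q n → coeff q n ≡ true → DegLt q (suc n) → isPrimeᵇ q n ≡ true →
  ∀ v → q ∣ v ⊎ Coprime q v
isPrimeᵇ-sound q n qn q< e v = ∨-elim (forallBits-sound n _ e (rem q n v)) divisible
  λ g1 → inj₂ (coprime-respʳ v≋ (coprime-add (quo q n v) (gcd⇒coprime q r g1)))
  where
  r = trim n (rem q n v)
  v≋ : q ⊠ quo q n v ⊞ r ≋ v
  v≋ = ≋-trans (⊞-cong ≋-refl (≋-sym (trim-≋ n (rem q n v) (rem-DegLt q n v qn q<)))) (quo-rem q n v)
  divisible : isZero r ≡ true → q ∣ v ⊎ Coprime q v
  divisible r0 = inj₁ (∣-respʳ v≋ (∣-add (∣-mulʳ _ ∣-refl) (∣-respʳ (≋-sym (isZero-sound r r0)) ∣[])))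

-- Monomials, small irreducible factors, and polynomials free of them.

mono : ℕ → 𝔽₂[x]
mono zero = 𝟙
mono (suc i) = false ∷ mono i

X-⊠ : ∀ p → X ⊠ p ≋ false ∷ p
X-⊠ p = ≋-trans (mul-shiftˡ 𝟙 p) (∷-cong refl (mul-identityˡ p))

mono-⊠ : ∀ i j → mono i ⊠ mono j ≋ mono (i + j)
mono-⊠ zero j = mul-identityˡ (mono j)
mono-⊠ (suc i) j = ≋-trans (mul-shiftˡ (mono i) (mono j)) (∷-cong refl (mono-⊠ i j))

coprime-mono : ∀ {p} i → Coprime p X → Coprime p (mono i)
coprime-mono zero c = coprime-𝟙
coprime-mono (suc i) c = coprime-respʳ (X-⊠ (mono i)) (coprime-mul c (coprime-mono i c))

-- The period of x modulo poly is suc order-1; 18 is the length of the longest range of exponents needed.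
record Factor : Set where
  field
    poly : 𝔽₂[x]
    order-1 : ℕ
    constant : val₀ poly ≡ true
    prime : ∀ v → poly ∣ v ⊎ Coprime poly v
    separates : ∀ {j k} → j < 18 → k < 18 → poly ∣ mono j ⊞ mono k → j % suc order-1 ≡ k % suc order-1

separatesAtᵇ : 𝔽₂[x] → ℕ → ℕ → ℕ → ℕ → Bool
separatesAtᵇ q n m j k = (j % suc m ≡ᵇ k % suc m) ∨ not (isZero (rem q n (mono j ⊞ mono k)))

separatesᵇ : 𝔽₂[x] → ℕ → ℕ → Bool
separatesᵇ q n m = allBelow 18 λ j → allBelow 18 (separatesAtᵇ q n m j)

factor : ∀ q n m → val₀ q ≡ true → coeff q n ≡ true → DegLt q (suc n) →
  isPrimeᵇ q n ≡ true → separatesᵇ q n m ≡ true → Factor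
factor q n m q0 qn q< p s = record
  { poly = q ; order-1 = m ; constant = q0 ; prime = isPrimeᵇ-sound q n qn q< p ; separates = sep }
  where
  sep : ∀ {j k} → j < 18 → k < 18 → q ∣ mono j ⊞ mono k → j % suc m ≡ k % suc m
  sep {j} {k} j< k< q∣ = ∨-elim (allBelow-sound 18 (separatesAtᵇ q n m j)
      (allBelow-sound 18 (λ j → allBelow 18 (separatesAtᵇ q n m j)) s j<) k<)
    (λ e → ℕₚ.≡ᵇ⇒≡ _ _ (subst T (sym e) tt))
    (λ e → ⊥-elim (absurd (∣⇒rem-isZero q n _ qn q< q∣) e))
    where
    absurd : ∀ {b} → b ≡ true → not b ≡ true → ⊥
    absurd refl ()

-- `Φ₃`, `Φ₅`, `Φ₉` are cyclotomic polynomials modulo 2; `Φ₇` and `Φ₇′` are the two cubics into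
-- which the seventh cyclotomic polynomial splits.
Φ₃ Φ₅ Φ₇ Φ₇′ Φ₉ : 𝔽₂[x]
Φ₃ = X²+X+1
Φ₅ = true ∷ true ∷ true ∷ true ∷ true ∷ []
Φ₇ = true ∷ true ∷ false ∷ true ∷ []
Φ₇′ = true ∷ false ∷ true ∷ true ∷ []
Φ₉ = true ∷ false ∷ false ∷ true ∷ false ∷ false ∷ true ∷ []

F₃ F₅ F₇ F₇′ : Factor
F₃ = factor Φ₃ 2 2 refl refl (length-DegLt Φ₃) refl refl
F₅ = factor Φ₅ 4 4 refl refl (length-DegLt Φ₅) refl refl
F₇ = factor Φ₇ 3 6 refl refl (length-DegLt Φ₇) refl refl
F₇′ = factor Φ₇′ 3 6 refl refl (length-DegLt Φ₇′) refl refl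

factors : List Factor
factors = F₃ ∷ F₅ ∷ F₇ ∷ F₇′ ∷ []

record Rough (v : 𝔽₂[x]) : Set where
  constructor rough
  field
    nonConstant : DegGe v 1
    coprime-x : Coprime v X
    coprime-x+1 : Coprime v X+1
    coprime-factors : All (Coprime v) (map Factor.poly factors)

prod : List 𝔽₂[x] → 𝔽₂[x]
prod = foldr _⊠_ 𝟙

coprime-prod : ∀ {v} ps → All (Coprime v) ps → Coprime v (prod ps)
coprime-prod [] [] = coprime-𝟙
coprime-prod (p ∷ ps) (c ∷ cs) = coprime-mul c (coprime-prod ps cs)

coprime-≡ : ∀ {v p} ps → isZero (prod ps ⊞ p) ≡ true → All (Coprime v) ps → Coprime v p
coprime-≡ {p = p} ps e cs = coprime-respʳ (⊞-isZero⇒≋ (prod ps) p e) (coprime-prod ps cs)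

-- For exponents 1 to 8, 1 + x^i is a product of copies of x + 1, `Φ₃`, `Φ₅`, `Φ₇` and `Φ₇′`; each
-- factorization is checked by evaluation.
rough-coprime : ∀ {v} → Rough v → ∀ m → m < 8 → Coprime v (𝟙 ⊞ mono (suc m))
rough-coprime (rough _ cx c₁ (c₃ ∷ c₅ ∷ c₇ ∷ c₇′ ∷ [])) m m<8 = go m m<8
  where
  go : ∀ m → m < 8 → Coprime _ (𝟙 ⊞ mono (suc m))
  go 0 _ = c₁
  go 1 _ = coprime-≡ (X+1 ∷ X+1 ∷ []) refl (c₁ ∷ c₁ ∷ [])
  go 2 _ = coprime-≡ (X+1 ∷ Φ₃ ∷ []) refl (c₁ ∷ c₃ ∷ [])
  go 3 _ = coprime-≡ (X+1 ∷ X+1 ∷ X+1 ∷ X+1 ∷ []) refl (c₁ ∷ c₁ ∷ c₁ ∷ c₁ ∷ [])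
  go 4 _ = coprime-≡ (X+1 ∷ Φ₅ ∷ []) refl (c₁ ∷ c₅ ∷ [])
  go 5 _ = coprime-≡ (X+1 ∷ X+1 ∷ Φ₃ ∷ Φ₃ ∷ []) refl (c₁ ∷ c₁ ∷ c₃ ∷ c₃ ∷ [])
  go 6 _ = coprime-≡ (X+1 ∷ Φ₇ ∷ Φ₇′ ∷ []) refl (c₁ ∷ c₇ ∷ c₇′ ∷ [])
  go 7 _ = coprime-≡ (X+1 ∷ X+1 ∷ X+1 ∷ X+1 ∷ X+1 ∷ X+1 ∷ X+1 ∷ X+1 ∷ []) refl
    (c₁ ∷ c₁ ∷ c₁ ∷ c₁ ∷ c₁ ∷ c₁ ∷ c₁ ∷ c₁ ∷ [])
  go (suc (suc (suc (suc (suc (suc (suc (suc _)))))))) (s≤s (s≤s (s≤s (s≤s (s≤s (s≤s (s≤s (s≤s ()))))))))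

hasFactorᵇ : List (ℕ × 𝔽₂[x]) → 𝔽₂[x] → Bool
hasFactorᵇ [] r = false
hasFactorᵇ ((n , q) ∷ qs) r = isZero (rem q n r) ∨ hasFactorᵇ qs r

hasFactorᵇ-sound : ∀ {v r} qs → v ≋ r → All (λ (_ , q) → DegGe q 1 × Coprime v q) qs → hasFactorᵇ qs r ≡ true → ⊥
hasFactorᵇ-sound {v} {r} ((n , q) ∷ qs) e ((q≥ , c) ∷ cs) h = ∨-elim h
  (λ z → coprime⇒¬common c (q , q≥ , ∣-respʳ (≋-sym e) (rem-isZero⇒∣ q n r z) , ∣-refl))
  (hasFactorᵇ-sound qs e cs)

-- All irreducible polynomials of degree at most 3, each preceded by its degree.
cubicFree : List (ℕ × 𝔽₂[x])
cubicFree = (1 , X) ∷ (1 , X+1) ∷ (2 , Φ₃) ∷ (3 , Φ₇) ∷ (3 , Φ₇′) ∷ []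

-- Exhaustion: each of the sixteen polynomials of degree below 4 is constant or divisible by a
-- member of `cubicFree`.
rough-DegGe : ∀ {v} → Rough v → DegGe v 4
rough-DegGe {v} (rough v≥ cx c₁ (c₃ ∷ c₅ ∷ c₇ ∷ c₇′ ∷ [])) with DegGe⊎DegLt v 4
... | inj₁ v≥4 = v≥4
... | inj₂ v<4 = ⊥-elim (∨-elim
  (forallBits-sound 4 (λ r → isConstant r ∨ hasFactorᵇ cubicFree r) refl v)
  (λ c → DegGe⇒¬DegLt (DegGe-resp v≋ v≥) (isConstant-sound _ c))
  (hasFactorᵇ-sound cubicFree v≋ ((coeff⇒DegGe refl , cx) ∷ (coeff⇒DegGe refl , c₁) ∷
    (DegGe-mono (s≤s z≤n) (coeff⇒DegGe {k = 2} refl) , c₃) ∷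
    (DegGe-mono (s≤s z≤n) (coeff⇒DegGe {k = 3} refl) , c₇) ∷
    (DegGe-mono (s≤s z≤n) (coeff⇒DegGe {k = 3} refl) , c₇′) ∷ [])))
  where
  v≋ : v ≋ trim 4 v
  v≋ = trim-≋ 4 v v<4

-- Covering failing exponents by coprime divisors.

dropClass : ℕ → ℕ → List ℕ → List ℕ
dropClass m r = filter λ j → ¬? (j % suc m ℕ.≟ r)

total : ℕ → ℕ → List ℕ → ℕ
total w acc = foldr (λ _ t → w + t) acc

-- Every choice of at most one residue class per factor, each choice adding its weight to acc,
-- leaves enough exponents of weight w in one of the two ranges to exceed D.
exceedsᵇ : ℕ → ℕ → List (Factor × ℕ) → ℕ → List ℕ → List ℕ → Bool
exceedsᵇ D w [] acc lo hi = (D <ᵇ total w acc lo) ∨ (D <ᵇ total w acc hi)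
exceedsᵇ D w ((F , k) ∷ Fs) acc lo hi = exceedsᵇ D w Fs acc lo hi ∧
  allBelow (suc m) (λ r → exceedsᵇ D w Fs (k + acc) (dropClass m r lo) (dropClass m r hi))
  where m = Factor.order-1 F

-- A record, so that the type checker does not unfold exceedsᵇ on open terms.
record Exceeds (D w : ℕ) (Fs : List (Factor × ℕ)) (acc : ℕ) (lo hi : List ℕ) : Set where
  constructor exceeds
  field holds : exceedsᵇ D w Fs acc lo hi ≡ true

-- The difference is between 1 and 8, the range of `rough-coprime`.
Close : ℕ → ℕ → Set
Close j k = ∃ λ m → m < 8 × k ≡ j + suc m

common⇒gcd : ∀ p q → DegGe p 0 → Common p q → DegGe (Bezout.gcd (gcdOf p q)) 1
common⇒gcd p q p≥ (d , d≥ , d∣p , d∣q) with gcdOf p q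
... | bezout g (divides s e) _ u v f with DegGe⊎DegLt g 0
...   | inj₁ g≥ = ∣-DegGe (∣-respʳ f (∣-add (∣-mulˡ u d∣p) (∣-mulˡ v d∣q))) g≥ d≥
...   | inj₂ g0 = ⊥-elim (DegGe⇒¬DegLt p≥
  (DegLt-resp (≋-trans (⊠-cong (≋-sym (DegLt0⇒≋[] g0)) (≋-refl {s})) e) DegLt-[]))

-- The weight of a member is a lower bound for its degree, or 1 when members are only counted.
record Family (a : 𝔽₂[x]) (W : 𝔽₂[x] → ℕ → Set) (C : 𝔽₂[x] → Set) (D : ℕ) : Set where
  constructor family
  field
    members : List (𝔽₂[x] × ℕ)
    weighted : All (λ (d , k) → W d k × d ∣ a × C d) members
    pairwise : AllPairs (Coprime on proj₁) members
    large : D < sum (map proj₂ members)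

module Cover (a b : 𝔽₂[x]) (lo : ℕ) (a₀ : val₀ a ≡ true) (a₁ : val₁ a ≡ true) where

  target w : ℕ → 𝔽₂[x]
  target j = b ⊞ mono (lo + j)
  w j = Bezout.gcd (gcdOf a (target j))

  w∣a : ∀ j → w j ∣ a
  w∣a j = Bezout.gcd∣p (gcdOf a (target j))

  w∣target : ∀ j → w j ∣ target j
  w∣target j = Bezout.gcd∣q (gcdOf a (target j))

  w-coprime-X : ∀ j → Coprime (w j) X
  w-coprime-X j = coprime-∣ˡ (w∣a j) (coprime-X a₀)

  target-difference : ∀ j k → target j ⊞ target k ≋ mono lo ⊠ (mono j ⊞ mono k)
  target-difference j k = ≋-trans (lemma b (mono (lo + j)) (mono (lo + k)))
    (≋-trans (⊞-cong (add-self b) (≋-refl {mono (lo + j) ⊞ mono (lo + k)}))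
    (≋-trans (⊞-cong (≋-sym (mono-⊠ lo j)) (≋-sym (mono-⊠ lo k)))
    (≋-sym (mul-distribˡ (mono lo) (mono j) (mono k)))))
    where
    lemma : ∀ x y z → x ⊞ y ⊞ (x ⊞ z) ≋ x ⊞ x ⊞ (y ⊞ z)
    lemma = solve-∀ 𝔽₂[x]-ring

  -- `b` cancels in the sum of the two targets, which leaves x^lo times x^j + x^k, and `d` is prime
  -- to x.
  target-separates : ∀ {d} j k → Coprime d X → d ∣ target j → d ∣ target k → d ∣ mono j ⊞ mono k
  target-separates j k c d∣j d∣k = coprime-cancel (coprime-mono lo c)
    (∣-respʳ (target-difference j k) (∣-add d∣j d∣k))

  -- Recorded for the count of irreducible factors: a common divisor of `b` and such a `d` divides a
  -- power of x.
  Hit : 𝔽₂[x] → Set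
  Hit d = ∃ λ j → d ∣ target j

  search : (F : Factor) → let q = Factor.poly F in ∀ N →
    (∃ λ j → j < N × q ∣ target j) ⊎ (∀ j → j < N → Coprime q (target j))
  search F zero = inj₂ λ _ ()
  search F (suc N) with Factor.prime F (target N)
  ... | inj₁ q∣ = inj₁ (N , ℕₚ.≤-refl , q∣)
  ... | inj₂ c with search F N
  ...   | inj₁ (j , j<N , q∣) = inj₁ (j , ℕₚ.m<n⇒m<1+n j<N , q∣)
  ...   | inj₂ cs = inj₂ go
    where
    go : ∀ j → j < suc N → Coprime (Factor.poly F) (target j)
    go j (s≤s j≤N) with j ℕ.≟ N
    ... | yes refl = c
    ... | no j≢N = cs j (ℕₚ.≤∧≢⇒< j≤N j≢N)

  -- `done` lists the small factors already treated; once it contains all four, the gcd at a live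
  -- exponent is rough.
  record Live (done : List 𝔽₂[x]) (j : ℕ) : Set where
    constructor live
    field
      bounded : j < 18
      nonConstant : DegGe (w j) 1
      coprimes : All (Coprime (w j)) done

  -- A common divisor of both gcds divides x^j times 1 + x^(m+1), and `w j` is coprime to both of
  -- these factors.
  shift-coprime : ∀ j m → DegGe (w j) 1 → Coprime (w j) (𝟙 ⊞ mono (suc m)) → Coprime (w j) (w (j + suc m))
  shift-coprime j m w≥ c with coprime⊎common (w j) (w (j + suc m)) (DegGe-mono z≤n w≥)
  ... | inj₁ c′ = c′
  ... | inj₂ (d , d≥ , d∣w , d∣w′) = ⊥-elim (coprime⇒¬common
    (coprime-mul (coprime-mono j (w-coprime-X j)) c)
    (d , d≥ , d∣w , ∣-respʳ shift (target-separates j (j + suc m) (coprime-∣ˡ d∣w (w-coprime-X j))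
      (∣-trans d∣w (w∣target j)) (∣-trans d∣w′ (w∣target (j + suc m))))))
    where
    shift : mono j ⊞ mono (j + suc m) ≋ mono j ⊠ (𝟙 ⊞ mono (suc m))
    shift = ≋-trans (⊞-cong (≋-sym (≋-trans (mul-comm (mono j) 𝟙) (mul-identityˡ (mono j))))
      (≋-sym (mono-⊠ j (suc m)))) (≋-sym (mul-distribˡ (mono j) 𝟙 (mono (suc m))))

  close⇒coprime : ∀ {j k} → Close j k → Rough (w j) → Coprime (w j) (w k)
  close⇒coprime {j} (m , m<8 , refl) R = shift-coprime j m (Rough.nonConstant R) (rough-coprime R m m<8)

  -- `W` fixes what a weight means, a lower bound for the degree or a unit in a count; `wt` is the
  -- weight of a rough divisor and `D` the total to exceed.
  module _ (W : 𝔽₂[x] → ℕ → Set) (D wt : ℕ) (rough-weight : ∀ {v} → Rough v → W v wt) where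

    Member : 𝔽₂[x] × ℕ → Set
    Member (d , k) = W d k × d ∣ a × Hit d

    roots : List (𝔽₂[x] × ℕ) → List ℕ → List (𝔽₂[x] × ℕ)
    roots ds = foldr (λ j → (w j , wt) ∷_) ds

    roots-All : ∀ {P : 𝔽₂[x] × ℕ → Set} {ds} js → All P ds → All (λ j → P (w j , wt)) js → All P (roots ds js)
    roots-All [] ps qs = ps
    roots-All (j ∷ js) ps (q ∷ qs) = q ∷ roots-All js ps qs

    roots-AllPairs : ∀ {ds} js → AllPairs Close js → All (Rough ∘ w) js →
      All (λ j → All (λ d → Coprime (w j) (proj₁ d)) ds) js →
      AllPairs (Coprime on proj₁) ds → AllPairs (Coprime on proj₁) (roots ds js)
    roots-AllPairs [] _ _ _ ps = ps
    roots-AllPairs (j ∷ js) (c ∷ cs) (R ∷ Rs) (q ∷ qs) ps =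
      roots-All js q (All.map (λ jk → close⇒coprime jk R) c) ∷ roots-AllPairs js cs Rs qs ps

    roots-sum : ∀ ds js → sum (map proj₂ (roots ds js)) ≡ total wt (sum (map proj₂ ds)) js
    roots-sum ds [] = refl
    roots-sum ds (j ∷ js) = cong (λ t → wt + t) (roots-sum ds js)

    <ᵇ-sound : ∀ m n → (m <ᵇ n) ≡ true → m < n
    <ᵇ-sound m n e = ℕₚ.<ᵇ⇒< m n (subst T (sym e) tt)

    Polys : List (Factor × ℕ) → List 𝔽₂[x]
    Polys = map (Factor.poly ∘ proj₁)

    -- With every small factor treated, the live gcds are rough, hence pairwise coprime by
    -- closeness; `sub` makes them coprime to the members already gathered.
    collect : ∀ {done ds} js → (∀ {v} → All (Coprime v) done → All (Coprime v) (map Factor.poly factors)) →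
      (∀ {v} → All (Coprime v) done → All (Coprime v ∘ proj₁) ds) →
      All Member ds → AllPairs (Coprime on proj₁) ds →
      AllPairs Close js → All (Live done) js → D < total wt (sum (map proj₂ ds)) js →
      Family a W Hit D
    collect {done} {ds} js K sub ms ps close ls D< = family (roots ds js)
      (roots-All js ms (All.map (λ {j} R → rough-weight R , w∣a j , j , w∣target j) Rs))
      (roots-AllPairs js close Rs (All.map (λ l → sub (Live.coprimes l)) ls) ps)
      (subst (D <_) (sym (roots-sum ds js)) D<)
      where
      isRough : ∀ {j} → Live done j → Rough (w j)
      isRough {j} (live _ w≥ cs) = rough w≥ (w-coprime-X j) (coprime-∣ˡ (w∣a j) (coprime-X+1 a₁)) (K cs)
      Rs : All (Rough ∘ w) js
      Rs = All.map isRough ls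

    -- Induction over the untreated factors, parallel to the recursion of `exceedsᵇ`. If `F` is
    -- coprime to `a` or to all targets, it meets no gcd and merely joins `done`. Otherwise it
    -- divides `a` and some target `j₀`: it becomes a member, and only exponents congruent to `j₀`
    -- modulo its order are given up.
    cover : ∀ Fs {done ds lo hi} →
      (∀ {v} → All (Coprime v) (Polys Fs) → All (Coprime v) done → All (Coprime v) (map Factor.poly factors)) →
      (∀ {v} → All (Coprime v) done → All (Coprime v ∘ proj₁) ds) →
      All (λ (F , k) → W (Factor.poly F) k × All (Coprime (Factor.poly F)) done) Fs →
      AllPairs (λ F G → Coprime (Factor.poly (proj₁ G)) (Factor.poly (proj₁ F))) Fs →
      All Member ds → AllPairs (Coprime on proj₁) ds →
      AllPairs Close lo → All (Live done) lo → AllPairs Close hi → All (Live done) hi →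
      Exceeds D wt Fs (sum (map proj₂ ds)) lo hi → Family a W Hit D
    -- The check guarantees only one of the two ranges; the family is collected from that one.
    cover [] {lo = lo} {hi} K sub _ _ ms ps lc ll hc hl (exceeds e) = ∨-elim e
      (λ e → collect lo (K []) sub ms ps lc ll (<ᵇ-sound _ _ e))
      (λ e → collect hi (K []) sub ms ps hc hl (<ᵇ-sound _ _ e))
    cover ((F , k) ∷ Fs) {done} {ds} {lo} {hi} K sub ((wF , cF) ∷ ws) (cFs ∷ cFss) ms ps lc ll hc hl (exceeds e) = split
      where
      q = Factor.poly F
      m = Factor.order-1 F
      K′ : ∀ {v} → All (Coprime v) (Polys Fs) → All (Coprime v) (q ∷ done) → All (Coprime v) (map Factor.poly factors)
      K′ cs (c ∷ ds) = K (c ∷ cs) ds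
      ws′ : All (λ (F , k) → W (Factor.poly F) k × All (Coprime (Factor.poly F)) (q ∷ done)) Fs
      ws′ = All.zipWith (λ (c , wF , cs) → wF , c ∷ cs) (cFs , ws)
      skip : (∀ j → j < 18 → Coprime (w j) q) → Family a W Hit D
      skip c = cover Fs K′ (λ { (_ ∷ cs) → sub cs }) ws′ cFss ms ps lc (All.map next ll) hc (All.map next hl) (exceeds (∧-trueˡ e))
        where
        next : ∀ {j} → Live done j → Live (q ∷ done) j
        next {j} (live j< w≥ cs) = live j< w≥ (c j j< ∷ cs)
      hit : ∀ j₀ → j₀ < 18 → q ∣ a → q ∣ target j₀ → Family a W Hit D
      hit j₀ j₀< q∣a q∣j₀ = cover Fs K′ (λ { (c ∷ cs) → c ∷ sub cs }) ws′ cFss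
        ((wF , q∣a , j₀ , q∣j₀) ∷ ms) (sub cF ∷ ps)
        (AllPairsₚ.filter⁺ P? lc) (next lo ll) (AllPairsₚ.filter⁺ P? hc) (next hi hl)
        (exceeds (allBelow-sound (suc m) (λ r → exceedsᵇ D wt Fs (k + sum (map proj₂ ds)) (dropClass m r lo) (dropClass m r hi))
          (∧-trueʳ {exceedsᵇ D wt Fs (sum (map proj₂ ds)) lo hi} e) (DivMod.m%n<n j₀ (suc m))))
        where
        P? = λ j → ¬? (j % suc m ℕ.≟ j₀ % suc m)
        miss : ∀ {j} → j % suc m ≢ j₀ % suc m → j < 18 → Coprime (w j) q
        miss {j} j≢ j< with Factor.prime F (target j)
        ... | inj₂ c = coprime-∣ˡ (w∣target j) (coprime-sym c)
        -- If `q` divides both targets, it divides x^j + x^j₀, so `j` lies in the class just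
        -- dropped.
        ... | inj₁ q∣j = ⊥-elim (j≢ (Factor.separates F j< j₀<
          (target-separates j j₀ (coprime-X (Factor.constant F)) q∣j q∣j₀)))
        next : ∀ js → All (Live done) js → All (Live (q ∷ done)) (dropClass m (j₀ % suc m) js)
        next js ls = All.zipWith (λ (j≢ , live j< w≥ cs) → live j< w≥ (miss j≢ j< ∷ cs))
          (Allₚ.all-filter P? js , Allₚ.filter⁺ P? ls)
      split : Family a W Hit D
      split with Factor.prime F a
      ... | inj₂ c = skip λ j _ → coprime-∣ˡ (w∣a j) (coprime-sym c)
      ... | inj₁ q∣a with search F 18
      ...   | inj₂ cs = skip λ j j< → coprime-∣ˡ (w∣target j) (coprime-sym (cs j j<))
      ...   | inj₁ (j₀ , j₀< , q∣j₀) = hit j₀ j₀< q∣a q∣j₀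

-- The two numerical checks and their consequences.

below : ℕ → List ℕ → List ℕ
below n = filter (ℕ._<? n)

-- Two blocks of nine consecutive exponents, so that differences within a block are at most 8.
low high : List ℕ
low = 0 ∷ 1 ∷ 2 ∷ 3 ∷ 4 ∷ 5 ∷ 6 ∷ 7 ∷ 8 ∷ []
high = map (λ j → 9 + j) low

weights : ℕ → ℕ → ℕ → List (Factor × ℕ)
weights w₃ w₅ w₇ = (F₃ , w₃) ∷ (F₅ , w₅) ∷ (F₇ , w₇) ∷ (F₇′ , w₇) ∷ []

-- The weights 2, 4, 3 are the degrees of `Φ₃`, `Φ₅` and both cubics, and a rough divisor has degree
-- at least 4. All eighteen values of `n` are evaluated.
degree-exceeds : ∀ {n} → n < 18 → Exceeds (suc n) 4 (weights 2 4 3) 0 (below (suc n) low) (below (suc n) high)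
degree-exceeds n<18 = exceeds (allBelow-sound 18
  (λ n → exceedsᵇ (suc n) 4 (weights 2 4 3) 0 (below (suc n) low) (below (suc n) high)) refl n<18)

-- Members are counted here: seventeen failing exponents force at least five of them.
unit-exceeds : Exceeds 4 1 (weights 1 1 1) 0 (below 17 low) (below 17 high)
unit-exceeds = exceeds refl

close : ∀ {b j k} → j < k × k ≤ j + b → ∃ λ m → m < b × k ≡ j + suc m
close {b} {j} {k} (j<k , k≤) with ℕₚ.m≤n⇒∃[o]m+o≡n j<k
... | m , refl = m , ℕₚ.+-cancelˡ-≤ j (suc m) b (subst (_≤ j + b) (sym (ℕₚ.+-suc j m)) k≤) , sym (ℕₚ.+-suc j m)

closeAll : ∀ b js {e} → AllPairs (λ j k → ∃ λ m → m < b × k ≡ j + suc m) js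
closeAll b js {e} =
  AllPairs.map close (toWitness {a? = AllPairs.allPairs? (λ j k → (j ℕ.<? k) ×-dec (k ℕ.≤? j + b)) js} e)

low-close : AllPairs Close low
low-close = closeAll 8 low

high-close : AllPairs Close high
high-close = closeAll 8 high

below18 : ∀ js {e} → All (_< 18) js
below18 js {e} = toWitness {a? = All.all? (ℕ._<? 18) js} e

coprime-polys : ∀ p q {e : isOne (Bezout.gcd (gcdOf p q)) ≡ true} → Coprime p q
coprime-polys p q {e} = gcd⇒coprime p q e

-- Starts `cover` with no factor treated and no member gathered; every failing exponent below `n` is
-- live because its gcd is nonconstant.
cover-all : ∀ (W : 𝔽₂[x] → ℕ → Set) D wt {w₃ w₅ w₇} → (∀ {v} → Rough v → W v wt) →
  W Φ₃ w₃ → W Φ₅ w₅ → W Φ₇ w₇ → W Φ₇′ w₇ →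
  ∀ a b lo (a₀ : val₀ a ≡ true) (a₁ : val₁ a ≡ true) n →
  (∀ j → j < n → Common a (b ⊞ mono (lo + j))) →
  Exceeds D wt (weights w₃ w₅ w₇) 0 (below n low) (below n high) →
  Family a W (Cover.Hit a b lo a₀ a₁) D
cover-all W D wt {w₃} {w₅} {w₇} rw W₃ W₅ W₇ W₇′ a b lo a₀ a₁ n bad e =
  cover W D wt rw (weights w₃ w₅ w₇) {done = []} {ds = []}
    (λ cs _ → cs) (λ _ → []) ((W₃ , []) ∷ (W₅ , []) ∷ (W₇ , []) ∷ (W₇′ , []) ∷ [])
    ((coprime-polys Φ₅ Φ₃ {refl} ∷ coprime-polys Φ₇ Φ₃ {refl} ∷ coprime-polys Φ₇′ Φ₃ {refl} ∷ []) ∷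
     (coprime-polys Φ₇ Φ₅ {refl} ∷ coprime-polys Φ₇′ Φ₅ {refl} ∷ []) ∷
     (coprime-polys Φ₇′ Φ₇ {refl} ∷ []) ∷ [] ∷ [])
    [] []
    (AllPairsₚ.filter⁺ (ℕ._<? n) low-close) (alive low (below18 low))
    (AllPairsₚ.filter⁺ (ℕ._<? n) high-close) (alive high (below18 high)) e
  where
  open Cover a b lo a₀ a₁
  alive : ∀ js → All (_< 18) js → All (Live []) (below n js)
  alive js js< = All.zipWith (λ {j} (j<n , j<18) → live j<18 (common⇒gcd a (target j) (coeff⇒DegGe a₀) (bad j j<n)) [])
    (Allₚ.all-filter (ℕ._<? n) js , Allₚ.filter⁺ (ℕ._<? n) js<)

family-product : ∀ {a} (C : 𝔽₂[x] → Set) (ds : List (𝔽₂[x] × ℕ)) → All (λ (d , k) → DegGe d k × d ∣ a × C d) ds →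
  AllPairs (Coprime on proj₁) ds → prod (map proj₁ ds) ∣ a × DegGe (prod (map proj₁ ds)) (sum (map proj₂ ds))
family-product {a} C [] _ _ = divides a (mul-identityˡ a) , coeff⇒DegGe refl
family-product C ((d , k) ∷ ds) ((d≥ , d∣a , _) ∷ ws) (cs ∷ css) with family-product C ds ws css
... | P∣a , P≥ = coprime-mul-∣ (coprime-prod (map proj₁ ds) (Allₚ.map⁺ cs)) d∣a P∣a , DegGe-mul d _ k _ d≥ P≥

family-degree : ∀ {a} {C : 𝔽₂[x] → Set} {D} → DegGe a 0 → DegLt a (suc D) → ¬ Family a DegGe C D
family-degree {C = C} a≥ a< (family ds ws ps D<) with family-product C ds ws ps
... | P∣a , P≥ = DegGe⇒¬DegLt (DegGe-mono D< (∣-DegGe P∣a a≥ P≥)) a<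

search-coprime : ∀ a → DegGe a 0 → (t : ℕ → 𝔽₂[x]) → ∀ n →
  (∃ λ j → j < n × Coprime a (t j)) ⊎ (∀ j → j < n → Common a (t j))
search-coprime a a≥ t zero = inj₂ λ _ ()
search-coprime a a≥ t (suc n) with coprime⊎common a (t n) a≥
... | inj₁ c = inj₁ (n , ℕₚ.≤-refl , c)
... | inj₂ c with search-coprime a a≥ t n
...   | inj₁ (j , j<n , c) = inj₁ (j , ℕₚ.m<n⇒m<1+n j<n , c)
...   | inj₂ cs = inj₂ go
  where
  go : ∀ j → j < suc n → Common a (t j)
  go j (s≤s j≤n) with j ℕ.≟ n
  ... | yes refl = c
  ... | no j≢n = cs j (ℕₚ.≤∧≢⇒< j≤n j≢n)

-- If all `suc n` exponents failed, pairwise coprime divisors of `a` would have total degree above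
-- `suc n`, the largest degree allowed for `a`.
degree-bound : ∀ a b lo → val₀ a ≡ true → val₁ a ≡ true → ∀ n → n < 18 → DegLt a (2 + n) →
  ∃ λ j → j < suc n × Coprime a (b ⊞ mono (lo + j))
degree-bound a b lo a₀ a₁ n n<18 a< with search-coprime a (coeff⇒DegGe a₀) (λ j → b ⊞ mono (lo + j)) (suc n)
... | inj₁ r = r
... | inj₂ bad = ⊥-elim (family-degree (coeff⇒DegGe a₀) a<
  (cover-all DegGe (suc n) 4 rough-DegGe (coeff⇒DegGe refl) (coeff⇒DegGe refl) (coeff⇒DegGe refl) (coeff⇒DegGe refl)
    a b lo a₀ a₁ (suc n) bad (degree-exceeds n<18)))

NonConstant₁ : 𝔽₂[x] → ℕ → Set
NonConstant₁ d k = DegGe d 1 × k ≡ 1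

unit-family : ∀ a b lo (a₀ : val₀ a ≡ true) (a₁ : val₁ a ≡ true) →
  (∀ j → j < 17 → Common a (b ⊞ mono (lo + j))) → Family a NonConstant₁ (Cover.Hit a b lo a₀ a₁) 4
unit-family a b lo a₀ a₁ bad = cover-all NonConstant₁ 4 1 (λ R → Rough.nonConstant R , refl)
  (nc Φ₃ 1 refl , refl) (nc Φ₅ 3 refl , refl) (nc Φ₇ 2 refl , refl) (nc Φ₇′ 2 refl , refl)
  a b lo a₀ a₁ 17 bad unit-exceeds
  where
  nc : ∀ q k → coeff q (suc k) ≡ true → DegGe q 1
  nc q k e = DegGe-mono (s≤s z≤n) (coeff⇒DegGe {k = suc k} e)

-- Counting irreducible factors.

-- The negated form is enough for contradictions. If no irreducible divides `p`, then `p` is itself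
-- irreducible: in a proper factorization the factor `a` has smaller degree and again no irreducible
-- divisor.
irreducible-divisor : ∀ n p → DegGe p 1 → DegLt p n → ¬ (∀ q → Irreducible q → ¬ q ∣ p)
irreducible-divisor zero p p≥ p< none = DegGe⇒¬DegLt p≥ (DegLt-mono z≤n p<)
irreducible-divisor (suc n) p p≥@(degGe i 1≤i pi) p< none = none p ((i , 1≤i , pi) , irr) ∣-refl
  where
  irr : ∀ a b → P2._≈P_ (mul a b) p → ¬ (P2.NonConstant a × P2.NonConstant b)
  irr a b e ((j , 1≤j , aj) , (k , 1≤k , bk)) with DegGe⊎DegLt a n
  ... | inj₂ a< = irreducible-divisor n a (degGe j 1≤j aj) a<
    λ q qi q∣a → none q qi (∣-trans q∣a (divides b (mk e)))
  ... | inj₁ a≥ = DegGe⇒¬DegLt (subst (DegGe p) (ℕₚ.+-comm n 1)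
    (DegGe-resp (mk e) (DegGe-mul a b n 1 a≥ (degGe k 1≤k bk)))) p<

remove : ∀ {q} ps → Any (P2._≈P_ q) ps → ∃ λ ps′ → length ps ≡ suc (length ps′) ×
  (∀ q′ → Any (P2._≈P_ q′) ps → q′ ≋ q ⊎ Any (P2._≈P_ q′) ps′)
remove {q} (p ∷ ps) (here e) = ps , refl , λ where
  q′ (here e′) → inj₁ (≋-trans (mk {q′} {p} e′) (≋-sym (mk {q} {p} e)))
  q′ (there m) → inj₂ m
remove (p ∷ ps) (there m) with remove ps m
... | ps′ , l , f = p ∷ ps′ , cong suc l , λ where
  q′ (here e′) → inj₂ (here e′)
  q′ (there m′) → map₂ there (f q′ m′)

-- Pigeonhole: an irreducible divisor `q` of the first member can be removed from `ps`, since the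
-- other members are coprime to the first and so not divisible by `q`.
coprime-factors-bound : ∀ ds ps → AllPairs Coprime ds →
  All (λ d → DegGe d 1 × (∀ q → Irreducible q → q ∣ d → Any (P2._≈P_ q) ps)) ds → ¬ length ps < length ds
coprime-factors-bound (d ∷ ds) ps (c ∷ cs) ((d≥ , f) ∷ fs) l< =
  irreducible-divisor (length d) d d≥ (length-DegLt d) λ q qi q∣d → step q q∣d (remove ps (f q qi q∣d))
  where
  step : ∀ q → q ∣ d → (∃ λ ps′ → length ps ≡ suc (length ps′) ×
    (∀ q′ → Any (P2._≈P_ q′) ps → q′ ≋ q ⊎ Any (P2._≈P_ q′) ps′)) → ⊥
  step q q∣d (ps′ , l , g) = coprime-factors-bound ds ps′ cs
    (All.zipWith (λ {d′} (c , d′≥ , f) → d′≥ , λ q′ qi q′∣d′ → rest c qi q′∣d′ (g q′ (f q′ qi q′∣d′))) (c , fs))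
    (ℕₚ.≤-pred (subst (_< suc (length ds)) l l<))
    where
    rest : ∀ {d′ q′} → Coprime d d′ → Irreducible q′ → q′ ∣ d′ →
      q′ ≋ q ⊎ Any (P2._≈P_ q′) ps′ → Any (P2._≈P_ q′) ps′
    rest _ _ _ (inj₂ m) = m
    rest {q′ = q′} c ((i , 1≤i , qi) , _) q′∣d′ (inj₁ e) =
      ⊥-elim (coprime⇒¬common c (q′ , degGe i 1≤i qi , ∣-respˡ (≋-sym e) q∣d , q′∣d′))

-- Removing powers of x and x + 1, and choosing an exponent.

-- The covering argument needs value 1 at 0 and at 1. Dividing out x and x + 1 achieves this and
-- loses no divisor `h` that itself has value 1 at both points.
record Stripped (a : 𝔽₂[x]) : Set where
  constructor stripped
  field
    core : 𝔽₂[x]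
    core₀ : val₀ core ≡ true
    core₁ : val₁ core ≡ true
    core∣ : core ∣ a
    keeps : ∀ {h} → val₀ h ≡ true → val₁ h ≡ true → h ∣ a → h ∣ core

cofactor-degree : ∀ {f t a n} → f ⊠ t ≋ a → DegGe f 1 → DegGe a 0 → DegLt a (suc n) → DegGe t 0 × DegLt t n
cofactor-degree {f} {t} {a} {n} e f≥ a≥ a< = nonzero (DegGe⊎DegLt t 0) , bounded (DegGe⊎DegLt t n)
  where
  nonzero : DegGe t 0 ⊎ DegLt t 0 → DegGe t 0
  nonzero (inj₁ t≥) = t≥
  nonzero (inj₂ t0) = ⊥-elim (DegGe⇒¬DegLt a≥ (DegLt-resp
    (≋-trans (≋-sym (≋-trans (⊠-cong (≋-refl {f}) (DegLt0⇒≋[] t0)) (mul-zeroʳ f))) e) DegLt-[]))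
  bounded : DegGe t n ⊎ DegLt t n → DegLt t n
  bounded (inj₁ t≥) = ⊥-elim (DegGe⇒¬DegLt (DegGe-resp e (DegGe-mul f t 1 n f≥ t≥)) a<)
  bounded (inj₂ t<) = t<

stripped-mul : ∀ {f t a} → f ⊠ t ≋ a → (∀ {h} → val₀ h ≡ true → val₁ h ≡ true → Coprime h f) → Stripped t → Stripped a
stripped-mul {f} e c (stripped k k₀ k₁ k∣t keep) = stripped k k₀ k₁ (∣-trans k∣t (∣-respʳ e (∣-mulˡ f ∣-refl)))
  λ h₀ h₁ h∣a → keep h₀ h₁ (coprime-cancel (c h₀ h₁) (∣-respʳ (≋-sym e) h∣a))

strip : ∀ n a → DegGe a 0 → DegLt a n → Stripped a
strip zero a a≥ a< = ⊥-elim (DegGe⇒¬DegLt a≥ a<)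
strip (suc n) a a≥ a< with val₀ a in e₀ | val₁ a in e₁
... | true | true = stripped a e₀ e₁ ∣-refl λ _ _ h∣ → h∣
... | false | _ with X∣⇐val₀ a e₀
...   | t , e with cofactor-degree {X} e (coeff⇒DegGe refl) a≥ a<
...     | t≥ , t< = stripped-mul e (λ h₀ _ → coprime-X h₀) (strip n t t≥ t<)
strip (suc n) a a≥ a< | true | false with X+1∣⇐val₁ a e₁
... | t , e with cofactor-degree {X+1} e (coeff⇒DegGe refl) a≥ a<
...   | t≥ , t< = stripped-mul e (λ _ h₁ → coprime-X+1 h₁) (strip n t t≥ t<)

Disjoint Disjoint₀₁ : 𝔽₂[x] → 𝔽₂[x] → Set
Disjoint a b = ∀ h → DegGe h 1 → h ∣ a → h ∣ b → ⊥
Disjoint₀₁ a b = ∀ h → DegGe h 1 → val₀ h ≡ true → val₁ h ≡ true → h ∣ a → h ∣ b → ⊥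

DegLt-∣ : ∀ {d a n} → DegGe a 0 → d ∣ a → DegLt a n → DegLt d n
DegLt-∣ {d} {n = n} a≥ d∣a a< with DegGe⊎DegLt d n
... | inj₁ d≥ = ⊥-elim (DegGe⇒¬DegLt (∣-DegGe d∣a a≥ d≥) a<)
... | inj₂ d< = d<

DegLt1⇒disjoint : ∀ {a b} → DegGe a 0 → DegLt a 1 → Disjoint a b
DegLt1⇒disjoint a≥ a< h h≥ h∣a _ = DegGe⇒¬DegLt h≥ (DegLt-∣ a≥ h∣a a<)

-- A common divisor of `v` and a member divides `b` and a target, hence a power of x, while `a` is
-- prime to x. So `v` joins the at least five members, one more than five irreducible factors
-- permit.
six-factors : ∀ a b lo (core₀ : val₀ a ≡ true) (core₁ : val₁ a ≡ true) {c} → a ∣ c → AtMostIrredFactors 5 c →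
  Common c b → ¬ Family a NonConstant₁ (Cover.Hit a b lo core₀ core₁) 4
six-factors a b lo a₀ a₁ {c} a∣c (ps , l≤ , f) (v , v≥ , v∣c , v∣b) (family ds ws pairs D<) =
  coprime-factors-bound (v ∷ map proj₁ ds) ps (Allₚ.map⁺ (All.map apart ws) ∷ AllPairsₚ.map⁺ pairs)
    ((v≥ , divisors v∣c) ∷ Allₚ.map⁺ (All.map (λ ((d≥ , _) , d∣a , _) → d≥ , divisors (∣-trans d∣a a∣c)) ws))
    (ℕₚ.≤-<-trans l≤ (s≤s (subst (4 <_) (count ds ws) D<)))
  where
  divisors : ∀ {d} → d ∣ c → ∀ q → Irreducible q → q ∣ d → Any (P2._≈P_ q) ps
  divisors d∣c q qi q∣d with ∣-trans q∣d d∣c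
  ... | divides t e = f q qi (t , at e)
  count : ∀ ds → All (λ (d , k) → NonConstant₁ d k × d ∣ a × Cover.Hit a b lo a₀ a₁ d) ds →
    sum (map proj₂ ds) ≡ length (map proj₁ ds)
  count [] [] = refl
  count ((d , _) ∷ ds) (((_ , refl) , _) ∷ ws) = cong suc (count ds ws)
  apart : ∀ {x} → NonConstant₁ (proj₁ x) (proj₂ x) × proj₁ x ∣ a × Cover.Hit a b lo a₀ a₁ (proj₁ x) → Coprime v (proj₁ x)
  apart {d , k} ((d≥ , _) , d∣a , j , d∣j) with coprime⊎common v d (DegGe-mono z≤n v≥)
  ... | inj₁ c = c
  ... | inj₂ (g , g≥ , g∣v , g∣d) = ⊥-elim (coprime⇒¬common
    (coprime-mono (lo + j) (coprime-∣ˡ (∣-trans g∣d d∣a) (coprime-X a₀)))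
    (g , g≥ , ∣-refl , ∣-add-cancelʳ (∣-respʳ (≡⇒≋ (add-comm b _)) (∣-trans g∣d d∣j)) (∣-trans g∣v v∣b)))

-- The number `N` of exponents is also the degree bound for `a`. Up to 18 the degree count decides;
-- beyond that, seventeen exponents and the bound on irreducible factors do.
choose : ∀ a b lo N → DegGe a 0 → DegLt a (suc N) → N ≤ 18 ⊎ AtMostIrredFactors 5 a →
  Disjoint a b ⊎ ∃ λ j → j < N × Disjoint₀₁ a (b ⊞ mono (lo + j))
choose a b lo zero a≥ a< _ = inj₁ (DegLt1⇒disjoint a≥ a<)
choose a b lo (suc n) a≥ a< bound with n ℕ.<? 18
... | yes n<18 = inj₂ (transfer (degree-bound core b lo core₀ core₁ n n<18 (DegLt-∣ a≥ core∣ a<)))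
  where
  open Stripped (strip (suc (suc n)) a a≥ a<)
  transfer : (∃ λ j → j < suc n × Coprime core (b ⊞ mono (lo + j))) → ∃ λ j → j < suc n × Disjoint₀₁ a (b ⊞ mono (lo + j))
  transfer (j , j< , c) = j , j< , λ h h≥ h₀ h₁ h∣a h∣b → coprime⇒¬common c (h , h≥ , keeps h₀ h₁ h∣a , h∣b)
choose a b lo (suc n) a≥ a< (inj₁ N≤18) | no n≮18 = ⊥-elim (n≮18 N≤18)
choose a b lo (suc n) a≥ a< (inj₂ few) | no n≮18 with coprime⊎common a b a≥
-- A coprime pair needs no change; a common divisor otherwise serves as the sixth factor.
... | inj₁ c = inj₁ λ h h≥ h∣a h∣b → coprime⇒¬common c (h , h≥ , h∣a , h∣b)
... | inj₂ common = inj₂ (go (search-coprime core (coeff⇒DegGe core₀) (λ j → b ⊞ mono (lo + j)) 17))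
  where
  open Stripped (strip (suc (suc n)) a a≥ a<)
  go : (∃ λ j → j < 17 × Coprime core (b ⊞ mono (lo + j))) ⊎ (∀ j → j < 17 → Common core (b ⊞ mono (lo + j))) →
    ∃ λ j → j < suc n × Disjoint₀₁ a (b ⊞ mono (lo + j))
  go (inj₁ (j , j<17 , c)) = j , ℕₚ.<-≤-trans j<17 (ℕₚ.≤-trans (ℕₚ.n≤1+n 17) (ℕₚ.≤-trans (ℕₚ.≮⇒≥ n≮18) (ℕₚ.n≤1+n n))) ,
    λ h h≥ h₀ h₁ h∣a h∣b → coprime⇒¬common c (h , h≥ , keeps h₀ h₁ h∣a , h∣b)
  go (inj₂ bad) = ⊥-elim (six-factors core b lo core₀ core₁ core∣ few common (unit-family core b lo core₀ core₁ bad))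

-- Even and odd halves, and squares.

evens-add : ∀ p q → evens (p ⊞ q) ≡ evens p ⊞ evens q
odds-add : ∀ p q → odds (p ⊞ q) ≡ odds p ⊞ odds q
evens-add [] q = refl
evens-add (a ∷ p) [] = refl
evens-add (a ∷ p) (b ∷ q) = cong ((a xor b) ∷_) (odds-add p q)
odds-add [] q = refl
odds-add (a ∷ p) [] = sym (add-identityʳ (evens p))
odds-add (a ∷ p) (b ∷ q) = evens-add p q

evens-scale : ∀ a p → evens (scale a p) ≡ scale a (evens p)
odds-scale : ∀ a p → odds (scale a p) ≡ scale a (odds p)
evens-scale a [] = refl
evens-scale a (b ∷ p) = cong ((a ∧ b) ∷_) (odds-scale a p)
odds-scale a [] = refl
odds-scale a (b ∷ p) = evens-scale a p

coeff-evens : ∀ p i → coeff (evens p) i ≡ coeff p (i * 2)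
coeff-odds : ∀ p i → coeff (odds p) i ≡ coeff p (suc (i * 2))
coeff-evens [] i = refl
coeff-evens (a ∷ p) zero = refl
coeff-evens (a ∷ p) (suc i) = coeff-odds p i
coeff-odds [] i = refl
coeff-odds (a ∷ p) i = coeff-evens p i

evens-cong : ∀ {p q} → p ≋ q → evens p ≋ evens q
evens-cong {p} {q} e = mk λ i → trans (coeff-evens p i) (trans (at e _) (sym (coeff-evens q i)))

odds-cong : ∀ {p q} → p ≋ q → odds p ≋ odds q
odds-cong {p} {q} e = mk λ i → trans (coeff-odds p i) (trans (at e _) (sym (coeff-odds q i)))

evens-mono : ∀ i → evens (mono (i * 2)) ≋ mono i
odds-mono : ∀ i → odds (mono (i * 2)) ≋ []
evens-mono zero = ≋-refl
evens-mono (suc i) = ∷-cong refl (evens-mono i)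
odds-mono zero = ≋-refl
odds-mono (suc i) = ≋-trans (∷-cong refl (odds-mono i)) 0∷0

val₁-mono : ∀ i → val₁ (mono i) ≡ true
val₁-mono zero = refl
val₁-mono (suc i) = val₁-mono i

spread : 𝔽₂[x] → 𝔽₂[x]
spread [] = []
spread (a ∷ p) = a ∷ false ∷ spread p

-- The Frobenius map: the cross term `scale a p` occurs twice and cancels.
square≋spread : ∀ p → p ⊠ p ≋ spread p
square≋spread [] = ≋-refl
square≋spread (a ∷ p) = ∷-cong (trans (𝔹ₚ.xor-identityʳ (a ∧ a)) (𝔹ₚ.∧-idem a))
  (≋-trans (⊞-cong (≋-refl {scale a p}) (mul-∷ʳ p a p))
  (≋-trans (≡⇒≋ (sym (add-assoc (scale a p) (scale a p) _)))
  (⊞-cong (add-self (scale a p)) (∷-cong refl (square≋spread p)))))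

evens-spread : ∀ h q → evens (spread h ⊠ q) ≋ h ⊠ evens q
odds-spread : ∀ h q → odds (spread h ⊠ q) ≋ h ⊠ odds q
evens-spread [] q = ≋-refl
evens-spread (a ∷ h) q = ≋-trans (≡⇒≋ (evens-add (scale a q) _)) (⊞-cong (≡⇒≋ (evens-scale a q))
  (∷-cong refl (≋-trans (≡⇒≋ (odds-add (scale false q) _))
  (⊞-cong (≋-trans (≡⇒≋ (odds-scale false q)) (scale-false (odds q))) (evens-spread h q)))))
odds-spread [] q = ≋-refl
odds-spread (a ∷ h) q = ≋-trans (≡⇒≋ (odds-add (scale a q) _)) (⊞-cong (≡⇒≋ (odds-scale a q))
  (≋-trans (≡⇒≋ (evens-add (scale false q) _))
  (⊞-cong (≋-trans (≡⇒≋ (evens-scale false q)) (scale-false (evens q))) (∷-cong refl (odds-spread h q)))))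

-- p = e(x²) + x o(x²) and h(x)² = h(x²), so multiplication by h² multiplies e and o by h.
square-∣-evens : ∀ {h p} → h ⊠ h ∣ p → h ∣ evens p
square-∣-evens {h} (divides q e) = divides (evens q)
  (≋-trans (≋-sym (evens-spread h q)) (evens-cong (≋-trans (⊠-cong (≋-sym (square≋spread h)) (≋-refl {q})) e)))

square-∣-odds : ∀ {h p} → h ⊠ h ∣ p → h ∣ odds p
square-∣-odds {h} (divides q e) = divides (odds q)
  (≋-trans (≋-sym (odds-spread h q)) (odds-cong (≋-trans (⊠-cong (≋-sym (square≋spread h)) (≋-refl {q})) e)))

-- Making the halves coprime by one change.

CoprimeHalves CoprimeHalves₁ : 𝔽₂[x] → Set
CoprimeHalves p = ∀ h → DegGe h 1 → h ∣ evens p → h ∣ odds p → ⊥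
CoprimeHalves₁ p = ∀ h → DegGe h 1 → val₁ h ≡ true → h ∣ evens p → h ∣ odds p → ⊥

-- After a change the weaker `CoprimeHalves₁` suffices, because the sign of the changed term is
-- still free. The exponent lies strictly between 0 and `d`, so the end coefficients stay.
data Fix (d : ℕ) (p : 𝔽₂[x]) : Set where
  keep : CoprimeHalves p → Fix d p
  flip : ∀ k → suc k < d → CoprimeHalves₁ (p ⊞ mono (suc k)) → Fix d p

halve : ∀ d → ∃ λ m → m * 2 ≤ d × d ≤ suc (m * 2)
halve zero = 0 , z≤n , z≤n
halve (suc zero) = 0 , z≤n , ℕₚ.≤-refl
halve (suc (suc d)) with halve d
... | m , l , u = suc m , s≤s (s≤s l) , s≤s (s≤s u)

DegLt-evens : ∀ {p d} m → d ≤ suc (m * 2) → DegLt p (suc d) → DegLt (evens p) (suc m)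
DegLt-evens {p} m d≤ (degLt p<) = degLt λ i m<i → trans (coeff-evens p i)
  (p< (i * 2) (ℕₚ.≤-trans (s≤s d≤) (ℕₚ.*-monoˡ-≤ 2 m<i)))

DegLt-odds : ∀ {p d} m → d ≤ suc m * 2 → DegLt p (suc d) → DegLt (odds p) (suc m)
DegLt-odds {p} m d≤ (degLt p<) = degLt λ i m<i → trans (coeff-odds p i)
  (p< (suc (i * 2)) (s≤s (ℕₚ.≤-trans d≤ (ℕₚ.*-monoˡ-≤ 2 m<i))))

val₁-⊞-mono : ∀ p k → val₁ p ≡ false → val₁ (p ⊞ mono k) ≡ true
val₁-⊞-mono p k e = trans (val₁-add p (mono k)) (cong₂ _xor_ e (val₁-mono k))

evens-flip : ∀ p j → evens (p ⊞ mono (j * 2)) ≋ evens p ⊞ mono j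
evens-flip p j = ≋-trans (≡⇒≋ (evens-add p _)) (⊞-cong (≋-refl {evens p}) (evens-mono j))

odds-flip : ∀ p j → odds (p ⊞ mono (j * 2)) ≋ odds p
odds-flip p j = ≋-trans (≡⇒≋ (odds-add p _))
  (≋-trans (⊞-cong (≋-refl {odds p}) (odds-mono j)) (≡⇒≋ (add-identityʳ (odds p))))

evens-flip′ : ∀ p j → evens (p ⊞ mono (suc (j * 2))) ≋ evens p
evens-flip′ p j = ≋-trans (≡⇒≋ (evens-add p _))
  (≋-trans (⊞-cong (≋-refl {evens p}) (≋-trans (∷-cong refl (odds-mono j)) 0∷0)) (≡⇒≋ (add-identityʳ (evens p))))

odds-flip′ : ∀ p j → odds (p ⊞ mono (suc (j * 2))) ≋ odds p ⊞ mono j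
odds-flip′ p j = ≋-trans (≡⇒≋ (odds-add p _)) (⊞-cong (≋-refl {odds p}) (evens-mono j))

val₀-evens : ∀ p → val₀ (evens p) ≡ val₀ p
val₀-evens p = coeff-evens p 0

small-degree-fix : ∀ d p → d ≤ 1 → DegLt p (suc d) → val₀ p ≡ true → Fix d p
small-degree-fix d p d≤1 p< p₀ =
  keep (DegLt1⇒disjoint (coeff⇒DegGe {k = 0} (trans (val₀-evens p) p₀)) (DegLt-evens 0 d≤1 p<))

-- The even half is changed at x^(j+1) with `j < N`, where `N` is (d - 1)/2 rounded down and bounds
-- the degree of the odd half. Starting at x keeps the constant term, so common divisors have value
-- 1 at 0.
fix-evens : ∀ d p → DegLt p (suc d) → val₀ p ≡ true → d ≤ 37 ⊎ AtMostIrredFactors 5 (odds p) → Fix d p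
fix-evens zero p p< p₀ bound = small-degree-fix 0 p z≤n p< p₀
fix-evens (suc zero) p p< p₀ bound = small-degree-fix 1 p ℕₚ.≤-refl p< p₀
fix-evens d@(suc (suc d′)) p p< p₀ bound with DegGe⊎DegLt (odds p) 0
-- A zero odd half becomes the constant 1 when x is added.
... | inj₂ o0 = flip 0 (s≤s (s≤s z≤n)) λ h h≥ _ _ h∣o → nonConstant∤𝟙 h≥
  (∣-respʳ (≋-trans (odds-flip′ p 0) (⊞-cong (DegLt0⇒≋[] o0) (≋-refl {𝟙}))) h∣o)
... | inj₁ o≥ with halve (suc d′)
...   | N , l , u with choose (odds p) (evens p) 1 N o≥ (DegLt-odds N (s≤s u) p<) (map₁ N≤18 bound)
  where
  N≤18 : d ≤ 37 → N ≤ 18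
  N≤18 d≤37 = ℕₚ.*-cancelʳ-≤ N 18 2 (ℕₚ.≤-trans l (ℕₚ.≤-pred d≤37))
...     | inj₁ disjoint = keep λ h h≥ h∣e h∣o → disjoint h h≥ h∣o h∣e
...     | inj₂ (j , j<N , disjoint) = flip (suc (j * 2)) (s≤s (ℕₚ.≤-trans (ℕₚ.*-monoˡ-≤ 2 j<N) l)) flipped
  where
  flipped : CoprimeHalves₁ (p ⊞ mono (suc j * 2))
  flipped h h≥ h₁ h∣e h∣o = disjoint h h≥
    (val₀-∣ h∣e (trans (val₀-evens (p ⊞ mono (suc j * 2))) (trans (coeff-add p _ 0) (cong (_xor false) p₀)))) h₁
    (∣-respʳ (odds-flip p (suc j)) h∣o) (∣-respʳ (evens-flip p (suc j)) h∣e)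

-- The roles are exchanged: the odd half is changed from x^0 on, as the even half already has
-- constant term 1.
fix-odds : ∀ d p → DegLt p (suc d) → val₀ p ≡ true → AtMostIrredFactors 5 (evens p) → Fix d p
fix-odds d p p< p₀ few with halve d
... | N , l , u with choose (evens p) (odds p) 0 N (coeff⇒DegGe {k = 0} (trans (val₀-evens p) p₀)) (DegLt-evens N u p<) (inj₂ few)
...   | inj₁ disjoint = keep disjoint
...   | inj₂ (j , j<N , disjoint) = flip (j * 2) (ℕₚ.≤-trans (ℕₚ.*-monoˡ-≤ 2 j<N) l) flipped
  where
  flipped : CoprimeHalves₁ (p ⊞ mono (suc (j * 2)))
  flipped h h≥ h₁ h∣e h∣o = disjoint h h≥ (val₀-∣ h∣e′ (trans (val₀-evens p) p₀)) h₁ h∣e′ (∣-respʳ (odds-flip′ p j) h∣o)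
    where h∣e′ = ∣-respʳ (evens-flip′ p j) h∣e

-- Multiplication by x turns the halves e, o of `q` into x o and e. Since e has constant term 1, its
-- divisor `h` is prime to x and can be cancelled against it.
shift-halves : ∀ {h} q → val₀ q ≡ true → h ∣ evens (false ∷ q) → h ∣ odds (false ∷ q) → h ∣ odds q
shift-halves q q₀ h∣e h∣o = coprime-cancel (coprime-X (val₀-∣ h∣o (trans (val₀-evens q) q₀)))
  (∣-respʳ (≋-sym (X-⊠ (odds q))) h∣e)

fix-shift : ∀ {d} q → val₀ q ≡ true → Fix d q → Fix (suc d) (false ∷ q)
fix-shift q q₀ (keep c) = keep λ h h≥ h∣e h∣o → c h h≥ h∣o (shift-halves q q₀ h∣e h∣o)
fix-shift q q₀ (flip k k< c) = flip (suc k) (s≤s k<) λ h h≥ h₁ h∣e h∣o →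
  c h h≥ h₁ h∣o (shift-halves (q ⊞ mono (suc k)) (trans (coeff-add q _ 0) (cong (_xor false) q₀)) h∣e h∣o)

-- Making the halves coprime by two or three changes.

-- Its degree 2 + 4 + 3 + 3 + 6 = 18 is the largest that `degree-bound` admits.
Ψ : 𝔽₂[x]
Ψ = prod (Φ₃ ∷ Φ₅ ∷ Φ₇ ∷ Φ₇′ ∷ Φ₉ ∷ [])

Ψ-DegLt : DegLt Ψ 19
Ψ-DegLt = DegLt-resp (≋-sym (⊞-isZero⇒≋ Ψ (trim 19 Ψ) refl)) (length-DegLt (trim 19 Ψ))

mono-DegLt : ∀ i → DegLt (mono i) (suc i)
mono-DegLt zero = length-DegLt 𝟙
mono-DegLt (suc i) = DegLt-∷ (mono-DegLt i)

positions : List ℕ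
positions = 0 ∷ 1 ∷ 2 ∷ 3 ∷ 4 ∷ 5 ∷ 6 ∷ 7 ∷ 8 ∷ 9 ∷ 10 ∷ []

-- Eleven pairwise coprime divisors of degree at least 4 do not fit into degree 40.
eleven-positions : ∀ a b → val₀ a ≡ true → val₁ a ≡ true → DegLt a 41 → Coprime a Ψ →
  ∃ λ k → k < 11 × Coprime a (b ⊞ mono k)
eleven-positions a b a₀ a₁ a< c with search-coprime a (coeff⇒DegGe a₀) (λ k → b ⊞ mono k) 11
... | inj₁ found = found
... | inj₂ bad = ⊥-elim (contradiction
    (product positions (toWitness {a? = All.all? (ℕ._<? 11) positions} tt) (closeAll 10 positions)))
  where
  open Cover a b 0 a₀ a₁
  divides-Ψ : ∀ {q} → q ∣ Ψ → Coprime a q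
  divides-Ψ q∣Ψ = coprime-∣ʳ q∣Ψ c
  w-coprime : ∀ {q} k → Coprime a q → Coprime (w k) q
  w-coprime k = coprime-∣ˡ (w∣a k)
  c₃ = divides-Ψ (rem-isZero⇒∣ Φ₃ 2 Ψ refl)
  c₅ = divides-Ψ (rem-isZero⇒∣ Φ₅ 4 Ψ refl)
  c₇ = divides-Ψ (rem-isZero⇒∣ Φ₇ 3 Ψ refl)
  c₇′ = divides-Ψ (rem-isZero⇒∣ Φ₇′ 3 Ψ refl)
  c₉ = divides-Ψ (rem-isZero⇒∣ Φ₉ 6 Ψ refl)
  w-rough : ∀ {k} → k < 11 → Rough (w k)
  w-rough {k} k< = rough (common⇒gcd a (target k) (coeff⇒DegGe a₀) (bad k k<)) (w-coprime-X k)
    (w-coprime k (coprime-X+1 a₁)) (w-coprime k c₃ ∷ w-coprime k c₅ ∷ w-coprime k c₇ ∷ w-coprime k c₇′ ∷ [])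
  w-differences : ∀ {k} m → m < 10 → Rough (w k) → Coprime (w k) (𝟙 ⊞ mono (suc m))
  w-differences {k} m m< R with m ℕ.<? 8
  ... | yes m<8 = rough-coprime R m m<8
  ... | no m≮8 with ℕₚ.m≤n⇒∃[o]m+o≡n (ℕₚ.≮⇒≥ m≮8)
  -- The two differences beyond 8: 1 + x^9 is (x + 1) `Φ₃` `Φ₉`, and 1 + x^10 is the square of (x +
  -- 1) `Φ₅`.
  ...   | 0 , refl = coprime-≡ (X+1 ∷ Φ₃ ∷ Φ₉ ∷ []) refl
    (w-coprime k (coprime-X+1 a₁) ∷ w-coprime k c₃ ∷ w-coprime k c₉ ∷ [])
  ...   | 1 , refl = coprime-≡ (X+1 ∷ X+1 ∷ Φ₅ ∷ Φ₅ ∷ []) refl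
    (w-coprime k (coprime-X+1 a₁) ∷ w-coprime k (coprime-X+1 a₁) ∷ w-coprime k c₅ ∷ w-coprime k c₅ ∷ [])
  ...   | suc (suc o) , refl = ⊥-elim (ℕₚ.m+n≮m 10 o m<)
  product : ∀ ks → All (_< 11) ks → AllPairs (λ j k → ∃ λ m → m < 10 × k ≡ j + suc m) ks →
    prod (map w ks) ∣ a × DegGe (prod (map w ks)) (length ks * 4)
  product [] _ _ = divides a (mul-identityˡ a) , coeff⇒DegGe refl
  product (k ∷ ks) (k< ∷ ks<) (d ∷ ds) with product ks ks< ds
  ... | P∣a , P≥ =
    coprime-mul-∣ (coprime-prod (map w ks) (Allₚ.map⁺ (All.map near d))) (w∣a k) P∣a ,
    DegGe-mul (w k) _ 4 _ (rough-DegGe (w-rough k<)) P≥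
    where
    near : ∀ {k′} → (∃ λ m → m < 10 × k′ ≡ k + suc m) → Coprime (w k) (w k′)
    near (m , m< , refl) = shift-coprime k m (Rough.nonConstant (w-rough k<)) (w-differences m m< (w-rough k<))
  contradiction : prod (map w positions) ∣ a × DegGe (prod (map w positions)) 44 → ⊥
  contradiction (P∣a , P≥) =
    DegGe⇒¬DegLt (DegGe-mono (toWitness {a? = 41 ℕ.≤? 44} tt) (∣-DegGe P∣a (coeff⇒DegGe a₀) P≥)) a<

-- Applied to `Ψ`, `degree-bound` yields a change that makes the even half coprime to `Ψ`; it also
-- turns the value at 1 from 0 to 1. The even half has degree at most 40, so `eleven-positions`
-- supplies the change of the odd half.
two-flips : ∀ d p → 37 ≤ d → d ≤ 81 → DegLt p (suc d) → val₀ p ≡ true → val₁ (evens p) ≡ false →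
  ∃ λ j → ∃ λ k → j < d × k < d × CoprimeHalves (p ⊞ mono j ⊞ mono k)
two-flips d p 37≤d d≤81 p< p₀ e₁ = start (degree-bound Ψ (evens p) 1 refl refl 17 ℕₚ.≤-refl Ψ-DegLt)
  where
  Result = ∃ λ j → ∃ λ k → j < d × k < d × CoprimeHalves (p ⊞ mono j ⊞ mono k)
  start : (∃ λ j → j < 18 × Coprime Ψ (evens p ⊞ mono (suc j))) → Result
  start (j , j<18 , c) = result (eleven-positions e (odds p) e₀ (val₁-⊞-mono (evens p) (suc j) e₁) e< (coprime-sym c))
    where
    e = evens p ⊞ mono (suc j)
    e₀ : val₀ e ≡ true
    e₀ = trans (coeff-add (evens p) _ 0) (cong (_xor false) (trans (val₀-evens p) p₀))
    e< : DegLt e 41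
    e< = DegLt-add (evens p) _ (DegLt-evens 40 d≤81 p<)
      (DegLt-mono (ℕₚ.≤-trans (s≤s j<18) (toWitness {a? = 19 ℕ.≤? 41} tt)) (mono-DegLt (suc j)))
    result : (∃ λ k → k < 11 × Coprime e (odds p ⊞ mono k)) → Result
    result (k , k<11 , c) = suc j * 2 , suc (k * 2) ,
      -- The exponents are at most 36 and 21, both below `d`.
      ℕₚ.≤-trans (s≤s (ℕₚ.*-monoˡ-≤ 2 j<18)) 37≤d ,
      ℕₚ.≤-trans (s≤s (s≤s (ℕₚ.*-monoˡ-≤ 2 (ℕₚ.≤-pred k<11)))) (ℕₚ.≤-trans (toWitness {a? = 22 ℕ.≤? 37} tt) 37≤d) ,
      λ h h≥ h∣e h∣o → coprime⇒¬common c (h , h≥ ,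
        ∣-respʳ (≋-trans (evens-flip′ p′ k) (evens-flip p (suc j))) h∣e ,
        ∣-respʳ (≋-trans (odds-flip′ p′ k) (⊞-cong (odds-flip p (suc j)) (≋-refl {mono k}))) h∣o)
      where p′ = p ⊞ mono (suc j * 2)

monos : List ℕ → 𝔽₂[x]
monos = foldr (λ k q → mono k ⊞ q) []

CoprimeHalves-resp : ∀ {p q} → p ≋ q → CoprimeHalves p → CoprimeHalves q
CoprimeHalves-resp e c h h≥ h∣e h∣o =
  c h h≥ (∣-respʳ (≋-sym (evens-cong e)) h∣e) (∣-respʳ (≋-sym (odds-cong e)) h∣o)

-- If the even half has value 1 at 1, a preliminary change at x^2 makes that value 0 and `two-flips`
-- applies.
three-flips : ∀ d p → 37 ≤ d → d ≤ 81 → DegLt p (suc d) → val₀ p ≡ true →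
  ∃ λ ks → length ks ≤ 3 × All (_< d) ks × CoprimeHalves (p ⊞ monos ks)
three-flips d p 37≤d d≤81 p< p₀ = split (val₁ (evens p)) refl
  where
  Result = ∃ λ ks → length ks ≤ 3 × All (_< d) ks × CoprimeHalves (p ⊞ monos ks)
  small : ∀ n {e} → n ≤ d
  small n {e} = ℕₚ.≤-trans (toWitness {a? = n ℕ.≤? 37} e) 37≤d
  two : (∃ λ j → ∃ λ k → j < d × k < d × CoprimeHalves (p ⊞ mono j ⊞ mono k)) → Result
  two (j , k , j< , k< , c) = j ∷ k ∷ [] , s≤s (s≤s z≤n) , j< ∷ k< ∷ [] , CoprimeHalves-resp
    (≡⇒≋ (trans (add-assoc p (mono j) (mono k)) (cong (λ t → p ⊞ (mono j ⊞ t)) (sym (add-identityʳ (mono k)))))) c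
  three : (∃ λ j → ∃ λ k → j < d × k < d × CoprimeHalves (p ⊞ mono 2 ⊞ mono j ⊞ mono k)) → Result
  three (j , k , j< , k< , c) = 2 ∷ j ∷ k ∷ [] , ℕₚ.≤-refl , small 3 ∷ j< ∷ k< ∷ [] , CoprimeHalves-resp
    (≡⇒≋ (trans (add-assoc (p ⊞ mono 2) (mono j) (mono k)) (trans (add-assoc p (mono 2) (mono j ⊞ mono k))
      (cong (λ t → p ⊞ (mono 2 ⊞ (mono j ⊞ t))) (sym (add-identityʳ (mono k))))))) c
  split : ∀ e → val₁ (evens p) ≡ e → Result
  split false e₁ = two (two-flips d p 37≤d d≤81 p< p₀ e₁)
  split true e₁ = three (two-flips d (p ⊞ mono 2) 37≤d d≤81
    (DegLt-add p _ p< (DegLt-mono (s≤s (small 2)) (mono-DegLt 2)))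
    (trans (coeff-add p _ 0) (cong (_xor false) p₀))
    (trans (val₁-resp (evens-flip p 1)) (trans (val₁-add (evens p) (mono 1)) (cong (_xor true) e₁))))

-- Reduction of integer polynomials modulo 2.

open import Data.Integer using (∣_∣)

-- Structural recursion makes the parity laws provable by induction, which `_% 2` does not offer
-- directly.
isOddᵇ : ℕ → Bool
isOddᵇ zero = false
isOddᵇ (suc n) = not (isOddᵇ n)

isOddᵇ-+ : ∀ m n → isOddᵇ (m + n) ≡ isOddᵇ m xor isOddᵇ n
isOddᵇ-+ zero n = refl
isOddᵇ-+ (suc m) n = trans (cong not (isOddᵇ-+ m n)) (𝔹ₚ.not-distribˡ-xor (isOddᵇ m) (isOddᵇ n))

isOddᵇ-* : ∀ m n → isOddᵇ (m * n) ≡ isOddᵇ m ∧ isOddᵇ n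
isOddᵇ-* zero n = refl
isOddᵇ-* (suc m) n = trans (isOddᵇ-+ n (m * n)) (trans (cong (isOddᵇ n xor_) (isOddᵇ-* m n)) (lemma (isOddᵇ m) (isOddᵇ n)))
  where
  lemma : ∀ a b → b xor (a ∧ b) ≡ not a ∧ b
  lemma false b = 𝔹ₚ.xor-identityʳ b
  lemma true b = 𝔹ₚ.xor-same b

isOddᵇ-⊖ : ∀ m n → isOddᵇ ∣ m ℤ.⊖ n ∣ ≡ isOddᵇ m xor isOddᵇ n
isOddᵇ-⊖ zero zero = refl
isOddᵇ-⊖ zero (suc n) = refl
isOddᵇ-⊖ (suc m) zero = sym (𝔹ₚ.xor-identityʳ _)
isOddᵇ-⊖ (suc m) (suc n) = trans (cong (λ z → isOddᵇ ∣ z ∣) (ℤₚ.[1+m]⊖[1+n]≡m⊖n m n))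
  (trans (isOddᵇ-⊖ m n) (sym (𝔹ₚ.xor-annihilates-not (isOddᵇ m) (isOddᵇ n))))

red≡isOddᵇ : ∀ z → red z ≡ isOddᵇ ∣ z ∣
red≡isOddᵇ z = go ∣ z ∣
  where
  go : ∀ n → (n % 2 ≡ᵇ 1) ≡ isOddᵇ n
  go zero = refl
  go (suc zero) = refl
  go (suc (suc n)) = trans (go n) (sym (𝔹ₚ.not-involutive _))

red-+ : ∀ a b → red (a ℤ.+ b) ≡ red a xor red b
red-+ a b = trans (red≡isOddᵇ (a ℤ.+ b)) (trans (go a b) (sym (cong₂ _xor_ (red≡isOddᵇ a) (red≡isOddᵇ b))))
  where
  go : ∀ a b → isOddᵇ ∣ a ℤ.+ b ∣ ≡ isOddᵇ ∣ a ∣ xor isOddᵇ ∣ b ∣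
  go (+ m) (+ n) = isOddᵇ-+ m n
  go (+ m) -[1+ n ] = isOddᵇ-⊖ m (suc n)
  go -[1+ m ] (+ n) = trans (isOddᵇ-⊖ n (suc m)) (𝔹ₚ.xor-comm (isOddᵇ n) _)
  go -[1+ m ] -[1+ n ] = trans (cong not (isOddᵇ-+ (suc m) n))
    (trans (𝔹ₚ.not-distribʳ-xor (isOddᵇ (suc m)) (isOddᵇ n)) refl)

red-* : ∀ a b → red (a ℤ.* b) ≡ red a ∧ red b
red-* a b = trans (red≡isOddᵇ (a ℤ.* b)) (trans (cong isOddᵇ (ℤₚ.abs-* a b))
  (trans (isOddᵇ-* ∣ a ∣ ∣ b ∣) (sym (cong₂ _∧_ (red≡isOddᵇ a) (red≡isOddᵇ b)))))

red-neg : ∀ a → red (- a) ≡ red a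
red-neg a = cong (λ n → n % 2 ≡ᵇ 1) (ℤₚ.∣-i∣≡∣i∣ a)

Odd⇒red : ∀ {z} → Odd z → red z ≡ true
Odd⇒red {z} odd with ∣ z ∣ % 2 in e | DivMod.m%n<n ∣ z ∣ 2
... | 0 | _ = ⊥-elim (odd (ℕD.m%n≡0⇒n∣m ∣ z ∣ 2 e))
... | 1 | _ = refl
... | suc (suc _) | s≤s (s≤s ())

Even⇒red : ∀ {z} → Even z → red z ≡ false
Even⇒red {z} even = cong (_≡ᵇ 1) (ℕD.n∣m⇒m%n≡0 ∣ z ∣ 2 even)

red⇒Even : ∀ {z} → red z ≡ false → Even z
red⇒Even {z} e with ∣ z ∣ % 2 in r | DivMod.m%n<n ∣ z ∣ 2
... | 0 | _ = ℕD.m%n≡0⇒n∣m ∣ z ∣ 2 r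
red⇒Even () | 1 | _
... | suc (suc _) | s≤s (s≤s ())

coeff-reduce : ∀ p i → coeff (reduce p) i ≡ red (PZ.coeff p i)
coeff-reduce [] i = refl
coeff-reduce (a ∷ p) zero = refl
coeff-reduce (a ∷ p) (suc i) = coeff-reduce p i

reduce-cong : ∀ {p q} → PZ._≈P_ p q → reduce p ≋ reduce q
reduce-cong {p} {q} e = mk λ i → trans (coeff-reduce p i) (trans (cong red (e i)) (sym (coeff-reduce q i)))

reduce-add : ∀ p q → reduce (PZ.add p q) ≡ reduce p ⊞ reduce q
reduce-add [] q = refl
reduce-add (a ∷ p) [] = refl
reduce-add (a ∷ p) (b ∷ q) = cong₂ _∷_ (red-+ a b) (reduce-add p q)

reduce-scale : ∀ a p → reduce (PZ.scale a p) ≡ scale (red a) (reduce p)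
reduce-scale a [] = refl
reduce-scale a (b ∷ p) = cong₂ _∷_ (red-* a b) (reduce-scale a p)

reduce-mul : ∀ p q → reduce (PZ.mul p q) ≡ reduce p ⊠ reduce q
reduce-mul [] q = refl
reduce-mul (a ∷ p) q = trans (reduce-add (PZ.scale a q) _)
  (cong₂ add (reduce-scale a q) (cong (false ∷_) (reduce-mul p q)))

noZeroDivisorsℤ : ∀ {a b : ℤ} → a ≢ + 0 → b ≢ + 0 → a ℤ.* b ≢ + 0
noZeroDivisorsℤ {a} a≢0 b≢0 e = [ a≢0 , b≢0 ] (ℤₚ.i*j≡0⇒i≡0∨j≡0 a e)

module DZ = Degree (+ 0) ℤ._+_ ℤ._*_ ℤₚ.+-identityˡ ℤₚ.+-identityʳ ℤₚ.*-zeroˡ ℤₚ.*-zeroʳ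
  noZeroDivisorsℤ ℤ._≟_

-- The value at -1 and criteria for square-freeness.

val₋₁ : ℤ[x] → ℤ
val₋₁ [] = + 0
val₋₁ (a ∷ p) = a ℤ.- val₋₁ p

val₋₁-zero : ∀ p → PZ._≈P_ p [] → val₋₁ p ≡ + 0
val₋₁-zero [] e = refl
val₋₁-zero (a ∷ p) e = cong₂ ℤ._-_ (e 0) (val₋₁-zero p λ i → e (suc i))

val₋₁-resp : ∀ p q → PZ._≈P_ p q → val₋₁ p ≡ val₋₁ q
val₋₁-resp [] q e = sym (val₋₁-zero q λ i → sym (e i))
val₋₁-resp (a ∷ p) [] e = val₋₁-zero (a ∷ p) e
val₋₁-resp (a ∷ p) (b ∷ q) e = cong₂ ℤ._-_ (e 0) (val₋₁-resp p q λ i → e (suc i))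

val₋₁-add : ∀ p q → val₋₁ (PZ.add p q) ≡ val₋₁ p ℤ.+ val₋₁ q
val₋₁-add [] q = sym (ℤₚ.+-identityˡ _)
val₋₁-add (a ∷ p) [] = sym (ℤₚ.+-identityʳ _)
val₋₁-add (a ∷ p) (b ∷ q) = trans (cong (λ t → (a ℤ.+ b) ℤ.- t) (val₋₁-add p q)) (lemma a b (val₋₁ p) (val₋₁ q))
  where
  lemma : ∀ a b x y → (a ℤ.+ b) ℤ.- (x ℤ.+ y) ≡ (a ℤ.- x) ℤ.+ (b ℤ.- y)
  lemma = ℤ-Solver.solve-∀

val₋₁-scale : ∀ a p → val₋₁ (PZ.scale a p) ≡ a ℤ.* val₋₁ p
val₋₁-scale a [] = sym (ℤₚ.*-zeroʳ a)
val₋₁-scale a (b ∷ p) = trans (cong (λ t → (a ℤ.* b) ℤ.- t) (val₋₁-scale a p)) (lemma a b (val₋₁ p))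
  where
  lemma : ∀ a b x → a ℤ.* b ℤ.- a ℤ.* x ≡ a ℤ.* (b ℤ.- x)
  lemma = ℤ-Solver.solve-∀

val₋₁-mul : ∀ p q → val₋₁ (PZ.mul p q) ≡ val₋₁ p ℤ.* val₋₁ q
val₋₁-mul [] q = refl
val₋₁-mul (a ∷ p) q = trans (val₋₁-add (PZ.scale a q) _)
  (trans (cong₂ (λ x y → x ℤ.+ (+ 0 ℤ.- y)) (val₋₁-scale a q) (val₋₁-mul p q)) (lemma a (val₋₁ p) (val₋₁ q)))
  where
  lemma : ∀ a x y → a ℤ.* y ℤ.+ (+ 0 ℤ.- x ℤ.* y) ≡ (a ℤ.- x) ℤ.* y
  lemma = ℤ-Solver.solve-∀

red-val₋₁ : ∀ p → red (val₋₁ p) ≡ val₁ (reduce p)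
red-val₋₁ [] = refl
red-val₋₁ (a ∷ p) = trans (red-+ a _) (cong (red a xor_) (trans (red-neg (val₋₁ p)) (red-val₋₁ p)))

-- If `h` were constant modulo 2, the reduction of `g` would be a constant times that of `q`, so `q`
-- would have an odd coefficient at `d`. Then the product of the square of `h` with `q` would have
-- degree at least d + 2.
reduce-nonConstant : ∀ {d} g h q → PZ.HasDegree g d → Odd (PZ.coeff g d) → PZ.NonConstant h →
  PZ._≈P_ (PZ.mul (PZ.mul h h) q) g → DegGe (reduce h) 1
reduce-nonConstant {d} g h q (_ , g<) odd (i , 1≤i , hi) e with DegGe⊎DegLt (reduce h) 1
... | inj₁ h≥ = h≥
... | inj₂ h< = ⊥-elim (nz (trans (sym (e index)) (trans (e index) (g< index (ℕₚ.≤-trans (ℕₚ.n≤1+n (suc d)) k≤index)))))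
  where
  h≋ : reduce h ≋ (coeff (reduce h) 0 ∷ [])
  h≋ = DegLt1⇒const h<
  -- The square of the constant, in the form in which `mul` evaluates it.
  c = coeff (reduce h) 0 ∧ coeff (reduce h) 0 xor false
  product : (c ∷ []) ⊠ reduce q ≋ reduce g
  product = ≋-trans (⊠-cong (≋-trans (≋-sym (⊠-cong h≋ h≋)) (≡⇒≋ (sym (reduce-mul h h)))) (≋-refl {reduce q}))
    (≋-trans (≡⇒≋ (sym (reduce-mul (PZ.mul h h) q))) (reduce-cong e))
  zero-at : ∀ d → coeff (false ∷ []) d ≡ false
  zero-at zero = refl
  zero-at (suc d) = refl
  q-odd : red (PZ.coeff q d) ≡ true
  q-odd = ∧-trueʳ {c} (trans (cong (c ∧_) (sym (coeff-reduce q d)))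
    (trans (sym (coeff-scale c (reduce q) d)) (trans (sym (𝔹ₚ.xor-identityʳ _))
    (trans (cong (coeff (scale c (reduce q)) d xor_) (sym (zero-at d)))
    (trans (sym (coeff-add (scale c (reduce q)) (false ∷ []) d))
    (trans (at product d) (trans (coeff-reduce g d) (Odd⇒red {PZ.coeff g d} odd))))))))
  q≥ : DZ.DegGe q d
  q≥ = DZ.degGe d ℕₚ.≤-refl λ z → true≢false (trans (sym q-odd) (cong red z))
  h≥ : DZ.DegGe h 1
  h≥ = DZ.degGe i 1≤i hi
  open DZ.DegGe (DZ.DegGe-mul (PZ.mul h h) q 2 d (DZ.DegGe-mul h h 1 1 h≥ h≥) q≥)
  nz : PZ.coeff g index ≢ + 0
  nz z = nonzero (trans (e index) z)

square-∣-reduce : ∀ g h q → PZ._≈P_ (PZ.mul (PZ.mul h h) q) g → reduce h ⊠ reduce h ∣ reduce g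
square-∣-reduce g h q e = divides (reduce q) (≋-trans
  (≡⇒≋ (sym (trans (reduce-mul (PZ.mul h h) q) (cong (_⊠ reduce q) (reduce-mul h h))))) (reduce-cong e))

squareFree : ∀ {d g} → PZ.HasDegree g d → Odd (PZ.coeff g d) → CoprimeHalves (reduce g) → SquareFree g
squareFree {g = g} g-deg odd c (h , h≥ , q , e) = c (reduce h) (reduce-nonConstant g h q g-deg odd h≥ e)
  (square-∣-evens h²∣g) (square-∣-odds h²∣g)
  where h²∣g = square-∣-reduce g h q e

-- If h̄(1) = 0 then h(−1) is even, so 4 divides g(−1) whenever h² divides g.
squareFree₁ : ∀ {d g} → PZ.HasDegree g d → Odd (PZ.coeff g d) → ¬ 4 ℕD.∣ ∣ val₋₁ g ∣ →
  CoprimeHalves₁ (reduce g) → SquareFree g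
squareFree₁ {d} {g} g-deg odd 4∤ c (h , h≥ , q , e) with val₁ (reduce h) in h₁
... | true = c (reduce h) (reduce-nonConstant g h q g-deg odd h≥ e) h₁ (square-∣-evens h²∣g) (square-∣-odds h²∣g)
  where h²∣g = square-∣-reduce g h q e
... | false = 4∤ (subst (4 ℕD.∣_) (sym value) (ℕD.∣m⇒∣m*n ∣ val₋₁ q ∣ (ℕD.*-pres-∣ 2∣h 2∣h)))
  where
  2∣h : 2 ℕD.∣ ∣ val₋₁ h ∣
  2∣h = red⇒Even {val₋₁ h} (trans (red-val₋₁ h) h₁)
  value : ∣ val₋₁ g ∣ ≡ ∣ val₋₁ h ∣ * ∣ val₋₁ h ∣ * ∣ val₋₁ q ∣
  value = trans (cong ∣_∣ (trans (sym (val₋₁-resp (PZ.mul (PZ.mul h h) q) g e)) (val₋₁-mul (PZ.mul h h) q)))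
    (trans (ℤₚ.abs-* (val₋₁ (PZ.mul h h)) (val₋₁ q)) (cong (_* ∣ val₋₁ q ∣)
    (trans (cong ∣_∣ (val₋₁-mul h h)) (ℤₚ.abs-* (val₋₁ h) (val₋₁ h)))))

-- Integer monomials and the length.

monoℤ : ℤ → ℕ → ℤ[x]
monoℤ s zero = s ∷ []
monoℤ s (suc k) = + 0 ∷ monoℤ s k

reduce-monoℤ : ∀ s k → red s ≡ true → reduce (monoℤ s k) ≡ mono k
reduce-monoℤ s zero e = cong (_∷ []) e
reduce-monoℤ s (suc k) e = cong (false ∷_) (reduce-monoℤ s k e)

monoℤ-DegLt : ∀ s k → DZ.DegLt (monoℤ s k) (suc k)
monoℤ-DegLt s zero = DZ.degLt λ { (suc i) _ → refl }
monoℤ-DegLt s (suc k) with monoℤ-DegLt s k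
... | DZ.degLt v = DZ.degLt λ { (suc i) (s≤s k<i) → v i k<i }

L-monoℤ : ∀ s k → L (monoℤ s k) ≡ ∣ s ∣
L-monoℤ s zero = ℕₚ.+-identityʳ ∣ s ∣
L-monoℤ s (suc k) = L-monoℤ s k

L-add : ∀ p q → L (PZ.add p q) ≤ L p + L q
L-add [] q = ℕₚ.≤-refl
L-add (a ∷ p) [] = ℕₚ.≤-reflexive (sym (ℕₚ.+-identityʳ _))
L-add (a ∷ p) (b ∷ q) = ℕₚ.≤-trans (ℕₚ.+-mono-≤ (ℤₚ.∣i+j∣≤∣i∣+∣j∣ a b) (L-add p q))
  (ℕₚ.≤-reflexive (interchange ∣ a ∣ ∣ b ∣ (L p) (L q)))
  where
  interchange : ∀ a b c d → (a + b) + (c + d) ≡ (a + c) + (b + d)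
  interchange = ℕ-Solver.solve-∀

L-sub : ∀ f c → L (sub f (PZ.add f c)) ≡ L c
L-sub [] [] = refl
L-sub [] (b ∷ c) = cong₂ _+_ (ℤₚ.∣-i∣≡∣i∣ b) (L-sub [] c)
L-sub (a ∷ f) [] = cong₂ _+_ (cong ∣_∣ (ℤₚ.+-inverseʳ a)) (trans (cong (λ g → L (sub f g)) (sym (add[] f))) (L-sub f []))
  where
  add[] : ∀ f → PZ.add f [] ≡ f
  add[] [] = refl
  add[] (a ∷ f) = refl
L-sub (a ∷ f) (b ∷ c) = cong₂ _+_ (trans (cong ∣_∣ (cancel a b)) (ℤₚ.∣-i∣≡∣i∣ b)) (L-sub f c)
  where
  cancel : ∀ a b → a ℤ.+ (- (a ℤ.+ b)) ≡ - b
  cancel = ℤ-Solver.solve-∀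

reduce-DegLt : ∀ {d f} → PZ.HasDegree f d → DegLt (reduce f) (suc d)
reduce-DegLt {f = f} (_ , f<) = degLt λ i d<i → trans (coeff-reduce f i) (cong red (f< i d<i))

monosℤ : List ℕ → ℤ[x]
monosℤ = foldr (λ k p → PZ.add (monoℤ (+ 1) k) p) []

reduce-monosℤ : ∀ ks → reduce (monosℤ ks) ≡ monos ks
reduce-monosℤ [] = refl
reduce-monosℤ (k ∷ ks) = trans (reduce-add (monoℤ (+ 1) k) _)
  (cong₂ add (reduce-monoℤ (+ 1) k refl) (reduce-monosℤ ks))

monosℤ-DegLt : ∀ {d} ks → All (_< d) ks → DZ.DegLt (monosℤ ks) d
monosℤ-DegLt [] [] = DZ.degLt λ _ _ → refl
monosℤ-DegLt (k ∷ ks) (k< ∷ ks<) with monoℤ-DegLt (+ 1) k | monosℤ-DegLt ks ks<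
... | DZ.degLt u | DZ.degLt v = DZ.degLt λ i d≤i → trans (DZ.coeff-add (monoℤ (+ 1) k) _ i)
  (cong₂ ℤ._+_ (u i (ℕₚ.≤-trans k< d≤i)) (v i d≤i))

L-monosℤ : ∀ ks → L (monosℤ ks) ≤ length ks
L-monosℤ [] = z≤n
L-monosℤ (k ∷ ks) = ℕₚ.≤-trans (L-add (monoℤ (+ 1) k) (monosℤ ks))
  (ℕₚ.+-mono-≤ (ℕₚ.≤-reflexive (L-monoℤ (+ 1) k)) (L-monosℤ ks))

∣val₋₁-monoℤ∣ : ∀ k → ∣ val₋₁ (monoℤ (+ 1) k) ∣ ≡ 1
∣val₋₁-monoℤ∣ zero = refl
∣val₋₁-monoℤ∣ (suc k) = trans (cong ∣_∣ (ℤₚ.+-identityˡ (- val₋₁ (monoℤ (+ 1) k))))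
  (trans (ℤₚ.∣-i∣≡∣i∣ (val₋₁ (monoℤ (+ 1) k))) (∣val₋₁-monoℤ∣ k))

val₋₁-neg : ∀ k → val₋₁ (monoℤ (- + 1) k) ≡ - val₋₁ (monoℤ (+ 1) k)
val₋₁-neg zero = refl
val₋₁-neg (suc k) = trans (cong (λ t → + 0 ℤ.- t) (val₋₁-neg k)) (lemma (val₋₁ (monoℤ (+ 1) k)))
  where
  lemma : ∀ x → + 0 ℤ.- (- x) ≡ - (+ 0 ℤ.- x)
  lemma = ℤ-Solver.solve-∀

-- Perturbing `f` below its leading coefficient.

module _ {d : ℕ} {f : ℤ[x]} (f-deg : PZ.HasDegree f d) (f-odd : Odd (PZ.coeff f d)) where

  coeff-perturbed : ∀ c → DZ.DegLt c d → ∀ i → d ≤ i → PZ.coeff (PZ.add f c) i ≡ PZ.coeff f i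
  coeff-perturbed c (DZ.degLt v) i d≤i = trans (DZ.coeff-add f c i)
    (trans (cong (λ t → PZ.coeff f i ℤ.+ t) (v i d≤i)) (ℤₚ.+-identityʳ _))

  perturbed-degree : ∀ c → DZ.DegLt c d → PZ.HasDegree (PZ.add f c) d
  perturbed-degree c c< = (λ z → proj₁ f-deg (trans (sym (coeff-perturbed c c< d ℕₚ.≤-refl)) z)) ,
    λ i d<i → trans (coeff-perturbed c c< i (ℕₚ.<⇒≤ d<i)) (proj₂ f-deg i d<i)

  perturbed-odd : ∀ c → DZ.DegLt c d → Odd (PZ.coeff (PZ.add f c) d)
  perturbed-odd c c< = subst Odd (sym (coeff-perturbed c c< d ℕₚ.≤-refl)) f-odd

  approx : ∀ {k} c → DZ.DegLt c d → L c ≤ k → SquareFree (PZ.add f c) → GoodApprox k f d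
  approx c c< Lc sf = PZ.add f c , perturbed-degree c c< , sf , subst (_≤ _) (sym (L-sub f c)) Lc

  approx-monos : ∀ {n} ks → length ks ≤ n → All (_< d) ks → CoprimeHalves (reduce f ⊞ monos ks) → GoodApprox n f d
  approx-monos ks l ks< c = approx (monosℤ ks) (monosℤ-DegLt ks ks<) (ℕₚ.≤-trans (L-monosℤ ks) l)
    (squareFree (perturbed-degree _ (monosℤ-DegLt ks ks<)) (perturbed-odd _ (monosℤ-DegLt ks ks<))
      (subst CoprimeHalves (sym (trans (reduce-add f (monosℤ ks)) (cong (reduce f ⊞_) (reduce-monosℤ ks)))) c))

  approx-mono : ∀ s k → red s ≡ true → ∣ s ∣ ≡ 1 → k < d → CoprimeHalves₁ (reduce f ⊞ mono k) →
    ¬ 4 ℕD.∣ ∣ val₋₁ f ℤ.+ val₋₁ (monoℤ s k) ∣ → GoodApprox 1 f d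
  approx-mono s k s-odd s1 k<d c 4∤ = approx (monoℤ s k) c< (ℕₚ.≤-reflexive (trans (L-monoℤ s k) s1))
    (squareFree₁ (perturbed-degree _ c<) (perturbed-odd _ c<)
      (subst (λ z → ¬ 4 ℕD.∣ ∣ z ∣) (sym (val₋₁-add f (monoℤ s k))) 4∤)
      (subst CoprimeHalves₁ (sym (trans (reduce-add f (monoℤ s k)) (cong (reduce f ⊞_) (reduce-monoℤ s k s-odd)))) c))
    where
    c< : DZ.DegLt (monoℤ s k) d
    c< with monoℤ-DegLt s k
    ... | DZ.degLt v = DZ.degLt λ i d≤i → v i (ℕₚ.≤-trans k<d d≤i)

  -- f(−1) + u and f(−1) − u differ by ±2, so 4 does not divide both.
  approx-fix : Fix d (reduce f) → GoodApprox 1 f d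
  approx-fix (keep c) = approx-monos [] z≤n [] (subst CoprimeHalves (sym (add-identityʳ (reduce f))) c)
  approx-fix (flip k k<d c) with 4 ℕD.∣? ∣ val₋₁ f ℤ.+ val₋₁ (monoℤ (+ 1) (suc k)) ∣
  ... | no 4∤ = approx-mono (+ 1) (suc k) refl refl k<d c 4∤
  ... | yes 4∣ = approx-mono (- + 1) (suc k) refl refl k<d c λ 4∣′ → absurd (subst (4 ℕD.∣_) two
    (ℤS.∣⇒∣ᵤ (ℤS.∣m∣n⇒∣m-n {+ 4} {x ℤ.+ u} {x ℤ.+ val₋₁ (monoℤ (- + 1) (suc k))} (ℤS.∣ᵤ⇒∣ 4∣) (ℤS.∣ᵤ⇒∣ 4∣′))))
    where
    absurd : ¬ 4 ℕD.∣ 2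
    absurd 4∣2 with ℕD.∣⇒≤ 4∣2
    ... | s≤s (s≤s ())
    x = val₋₁ f
    u = val₋₁ (monoℤ (+ 1) (suc k))
    two : ∣ (x ℤ.+ u) ℤ.- (x ℤ.+ val₋₁ (monoℤ (- + 1) (suc k))) ∣ ≡ 2
    two = trans (cong ∣_∣ (trans (cong (λ v → (x ℤ.+ u) ℤ.- (x ℤ.+ v)) (val₋₁-neg (suc k))) (lemma x u)))
      (trans (ℤₚ.abs-* (+ 2) u) (cong (2 *_) (∣val₋₁-monoℤ∣ (suc k))))
      where
      lemma : ∀ x u → (x ℤ.+ u) ℤ.- (x ℤ.+ (- u)) ≡ + 2 ℤ.* u
      lemma = ℤ-Solver.solve-∀

-- From the hypotheses on `f` to the four statements.

fewer-factors : ∀ q → AtMostIrredFactors 5 (false ∷ q) → AtMostIrredFactors 5 q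
fewer-factors q (ps , l , f) = ps , l , λ r ri (t , e) → f r ri (lift r (divides t (mk e)))
  where
  lift : ∀ r → r ∣ q → P2._∣P_ r (false ∷ q)
  lift r r∣q with ∣-respʳ (X-⊠ q) (∣-mulˡ X r∣q)
  ... | divides t e = t , at e

-- Write p = x q. Then `evens p` is x times `odds q` and `odds p` is `evens q`, so the bounds pass
-- to `odds q`, and `q` has constant term 1 as `fix-evens` requires.
fix-shifted : ∀ d p → DegLt p (suc d) → d ≤ 37 ⊎ AtMostIrredFactors 5 (evens p) →
  val₀ p ≡ false → val₀ (odds p) ≡ true → Fix d p
fix-shifted zero (false ∷ q) (degLt p<) bound p₀ o₀ =
  ⊥-elim (true≢false (trans (sym o₀) (trans (val₀-evens q) (p< 1 (s≤s z≤n)))))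
fix-shifted (suc n) (false ∷ q) p< bound p₀ o₀ = fix-shift q q₀
  (fix-evens n q (DegLt-tail p<) q₀ (map-⊎ (ℕₚ.≤-trans (ℕₚ.n≤1+n n)) (fewer-factors (odds q)) bound))
  where
  q₀ : val₀ q ≡ true
  q₀ = trans (sym (val₀-evens q)) o₀

X∤⇒val₀ : ∀ p → ¬ P2._∣P_ X p → val₀ p ≡ true
X∤⇒val₀ p X∤p with val₀ p in p₀
... | true = refl
... | false with X∣⇐val₀ p p₀
...   | t , e = ⊥-elim (X∤p (t , at e))

-- The constant term of the odd half is the coefficient of x; were it zero too, x could be divided
-- out twice.
X²∤⇒val₀-odds : ∀ p → val₀ p ≡ false → ¬ P2._∣P_ X² p → val₀ (odds p) ≡ true
X²∤⇒val₀-odds p p₀ X²∤p with val₀ (odds p) in o₀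
... | true = refl
... | false with X∣⇐val₀ p p₀
...   | t , e with X∣⇐val₀ t (trans (sym (at (X-⊠ t) 1)) (trans (at e 1) (trans (sym (coeff-odds p 0)) o₀)))
...     | s , e′ = ⊥-elim (X²∤p (s , at (≋-trans (⊠-cong (⊞-isZero⇒≋ X² (X ⊠ X) refl) (≋-refl {s}))
  (≋-trans (mul-assoc X X s) (≋-trans (⊠-cong (≋-refl {X}) e′) e)))))

-- A half not divisible by x has constant term 1. For the even half this is the constant term of
-- `p`; for the odd half it is the coefficient of x, and `p` may still be divisible by x once.
fix-halves : ∀ d p → DegLt p (suc d) →
  ((NotDivBySmall (evens p) × AtMostIrredFactors 5 (odds p)) ⊎
   (NotDivBySmall (odds p) × AtMostIrredFactors 5 (evens p))) → Fix d p
fix-halves d p p< (inj₁ ((X∤e , _) , few)) =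
  fix-evens d p p< (trans (sym (val₀-evens p)) (X∤⇒val₀ (evens p) X∤e)) (inj₂ few)
fix-halves d p p< (inj₂ ((X∤o , _) , few)) with val₀ p in p₀
... | true = fix-odds d p p< p₀ few
... | false = fix-shifted d p p< (inj₂ few) p₀ (X∤⇒val₀ (odds p) X∤o)

theorem5p6 :
    (∀ (d : ℕ) (f : ℤ[x]) → d ≤ 36 → PZ.HasDegree f d →
        Odd (PZ.coeff f d) → Odd (PZ.coeff f 0) → GoodApprox 1 f d)
    ×
    (∀ (d : ℕ) (f : ℤ[x]) → d ≤ 37 → PZ.HasDegree f d →
        Odd (PZ.coeff f d) → Even (PZ.coeff f 0) →
        SimpleRootZero (reduce f) → GoodApprox 1 f d)
    ×
    (∀ (d : ℕ) (f : ℤ[x]) → d ≤ 81 → PZ.HasDegree f d →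
        Odd (PZ.coeff f d) → Odd (PZ.coeff f 0) → GoodApprox 3 f d)
    ×
    (∀ (d : ℕ) (f : ℤ[x]) → 9 ≤ d → PZ.HasDegree f d →
        Odd (PZ.coeff f d) →
        ((NotDivBySmall (evens (reduce f)) × AtMostIrredFactors 5 (odds (reduce f)))
         ⊎ (NotDivBySmall (odds (reduce f)) × AtMostIrredFactors 5 (evens (reduce f)))) →
        GoodApprox 1 f d)
theorem5p6 = part₁ , part₂ , part₃ , part₄
  where
  reduced₀ : ∀ f → Odd (PZ.coeff f 0) → val₀ (reduce f) ≡ true
  reduced₀ f f₀ = trans (coeff-reduce f 0) (Odd⇒red {PZ.coeff f 0} f₀)
  -- Degree 37 is included, so that `part₃` turns to `three-flips` only from degree 38 on.
  low-degree : ∀ d f → d ≤ 37 → PZ.HasDegree f d → Odd (PZ.coeff f d) → Odd (PZ.coeff f 0) → GoodApprox 1 f d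
  low-degree d f d≤37 f-deg f-odd f₀ = approx-fix f-deg f-odd
    (fix-evens d (reduce f) (reduce-DegLt {f = f} f-deg) (reduced₀ f f₀) (inj₁ d≤37))
  part₁ : _
  part₁ d f d≤36 = low-degree d f (ℕₚ.≤-trans d≤36 (ℕₚ.n≤1+n 36))
  part₂ : _
  part₂ d f d≤37 f-deg f-odd f₀ (_ , X²∤f) = approx-fix f-deg f-odd
    (fix-shifted d (reduce f) (reduce-DegLt {f = f} f-deg) (inj₁ d≤37) f̄₀ (X²∤⇒val₀-odds (reduce f) f̄₀ X²∤f))
    where
    f̄₀ : val₀ (reduce f) ≡ false
    f̄₀ = trans (coeff-reduce f 0) (Even⇒red {PZ.coeff f 0} f₀)
  part₃ : _
  part₃ d f d≤81 f-deg f-odd f₀ with d ℕ.≤? 37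
  ... | yes d≤37 with low-degree d f d≤37 f-deg f-odd f₀
  ...   | g , g-deg , g-sf , l = g , g-deg , g-sf , ℕₚ.≤-trans l (s≤s z≤n)
  part₃ d f d≤81 f-deg f-odd f₀ | no d≰37 = flips
    (three-flips d (reduce f) (ℕₚ.≤-trans (ℕₚ.n≤1+n 37) (ℕₚ.≰⇒> d≰37)) d≤81 (reduce-DegLt {f = f} f-deg) (reduced₀ f f₀))
    where
    flips : (∃ λ ks → length ks ≤ 3 × All (_< d) ks × CoprimeHalves (reduce f ⊞ monos ks)) → GoodApprox 3 f d
    flips (ks , l , ks< , c) = approx-monos f-deg f-odd ks l ks< c
  part₄ : _
  part₄ d f _ f-deg f-odd h = approx-fix f-deg f-odd (fix-halves d (reduce f) (reduce-DegLt {f = f} f-deg) h)
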